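{- Let $M$ be a paving matroid of rank $r$ on ground set $[n]$, let $\mathcal{H}$ be its set of hyperplanes, and for $r\le s\le n-1$ let $\mathcal{H}_s=\{H\in\mathcal{H}: |H|=s\}$. Then for every nonnegative integer $t$, \[ \mathrm{ehr}_{M}(t)=\mathrm{ehr}_{U_{r,n}}(t)-\sum_{s=r}^{n-1}|\mathcal{H}_s|\sum_{m=0}^{t-1}\sum_{i=0}^{s-r}(-1)^i\binom{s}{i}\binom{t(s-r-i)+m+s-1-i}{s-1}\binom{m+n-s-1}{m}. \]
   Context: A matroid of rank $r$ is paving if every circuit has cardinality at least $r$. A hyperplane is a flat of rank $r-1$. $U_{r,n}$ is the uniform matroid on $[n]$ whose bases are all $r$-subsets. The base polytope of $M$ on $[n]$ is $\mathcal{P}_M=\mathrm{conv}\{\sum_{i\in B}\mathbf{e}_i: B\text{ a basis}\}\subset\mathbb{R}^n$ and $\mathrm{ehr}_M(t)=|t\mathcal{P}_M\cap\mathbb{Z}^n|$ for nonnegative integers $t$. -}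

module Defs where

open import Data.Nat using (ℕ; zero; suc; _+_; _*_; _∸_; _≤_; _⊔_; _<ᵇ_; _≡ᵇ_)
open import Data.Nat.Combinatorics using (_C_)
open import Data.Bool using (Bool; true; false; T; if_then_else_; _∧_; _∨_; not)
open import Data.Fin using (Fin)
open import Data.Fin.Subset using (Subset; inside; outside; _∈_; _∉_; _⊆_; _⊂_; ∣_∣; _∩_; _∪_; ⁅_⁆)
open import Data.Vec using (Vec; []; _∷_; lookup; _[_]≔_)
open import Data.List using (List; []; _∷_; map; filter; length; foldr; _++_; upTo; allFin)
open import Data.List.Relation.Unary.All using (All)
open import Data.List.Relation.Unary.Unique.Propositional using (Unique)
open import Data.List.Membership.Propositional using () renaming (_∈_ to _∈ₗ_)
open import Data.Product using (Σ; ∃; _×_; _,_; proj₁; proj₂)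
open import Data.Integer as ℤ using (ℤ; +_; -[1+_])
open import Data.Rational as ℚ using (ℚ; 0ℚ; 1ℚ)
open import Relation.Nullary using (¬_)
open import Relation.Binary.PropositionalEquality using (_≡_)

subsets : (n : ℕ) → List (Subset n)
subsets zero    = [] ∷ []
subsets (suc n) = map (outside ∷_) (subsets n) ++ map (inside ∷_) (subsets n)

record Matroid (n : ℕ) : Set where
  field
    isBasis  : Subset n → Bool
    nonempty : ∃ λ B → T (isBasis B)
    exchange : ∀ B₁ B₂ → T (isBasis B₁) → T (isBasis B₂) →
               ∀ x → x ∈ B₁ → x ∉ B₂ →
               ∃ λ y → y ∈ B₂ × y ∉ B₁ ×
                 T (isBasis ((B₁ [ x ]≔ outside) [ y ]≔ inside))
open Matroid public

bases : ∀ {n} → Matroid n → List (Subset n)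
bases {n} M = filter (λ B → T? (isBasis M B)) (subsets n)
  where
  open import Data.Bool.Properties using (T?)

HasRank : ∀ {n} → Matroid n → ℕ → Set
HasRank M r = ∀ B → T (isBasis M B) → ∣ B ∣ ≡ r

Independent : ∀ {n} → Matroid n → Subset n → Set
Independent M A = ∃ λ B → T (isBasis M B) × A ⊆ B

Circuit : ∀ {n} → Matroid n → Subset n → Set
Circuit M C = ¬ Independent M C × (∀ D → D ⊂ C → Independent M D)

Paving : ∀ {n} → Matroid n → ℕ → Set
Paving M r = ∀ C → Circuit M C → r ≤ ∣ C ∣

rk : ∀ {n} → Matroid n → Subset n → ℕ
rk M A = foldr _⊔_ 0 (map (λ B → ∣ A ∩ B ∣) (bases M))

isFlat : ∀ {n} → Matroid n → Subset n → Bool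
isFlat {n} M A = foldr _∧_ true (map (λ x → lookup A x ∨ (rk M A <ᵇ rk M (A ∪ ⁅ x ⁆))) (allFin n))

-- hyperplanes of a rank-r matroid: flats of rank r - 1 (none if r = 0)
isHyperplane : ∀ {n} → Matroid n → ℕ → Subset n → Bool
isHyperplane M r H = isFlat M H ∧ (suc (rk M H) ≡ᵇ r)

numHyperplanes : ∀ {n} → Matroid n → ℕ → ℕ → ℕ
numHyperplanes {n} M r s =
  length (filter (λ H → T? (isHyperplane M r H ∧ (∣ H ∣ ≡ᵇ s))) (subsets n))
  where
  open import Data.Bool.Properties using (T?)

sumℚ : List ℚ → ℚ
sumℚ = foldr ℚ._+_ 0ℚ

indicator : ∀ {n} → Subset n → Fin n → ℚ
indicator B i = if lookup B i then 1ℚ else 0ℚ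

InDilatedBasePolytope : ∀ {n} → (Subset n → Bool) → ℕ → Vec ℤ n → Set
InDilatedBasePolytope {n} isB t x =
  ∃ λ (cs : List (Subset n × ℚ)) →
    All (λ p → T (isB (proj₁ p)) × 0ℚ ℚ.≤ proj₂ p) cs ×
    sumℚ (map proj₂ cs) ≡ (+ t) ℚ./ 1 ×
    (∀ i → sumℚ (map (λ p → proj₂ p ℚ.* indicator (proj₁ p) i) cs)
           ≡ (lookup x i) ℚ./ 1)

EhrIs : ∀ {n} → (Subset n → Bool) → ℕ → ℕ → Set
EhrIs {n} isB t k =
  ∃ λ (L : List (Vec ℤ n)) →
    Unique L × length L ≡ k ×
    All (InDilatedBasePolytope isB t) L ×
    (∀ x → InDilatedBasePolytope isB t x → x ∈ₗ L)

uniformBasis : ∀ {n} → ℕ → Subset n → Bool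
uniformBasis r B = ∣ B ∣ ≡ᵇ r

sumℤ : List ℤ → ℤ
sumℤ = foldr ℤ._+_ (+ 0)

correction : ∀ {n} → Matroid n → ℕ → ℕ → ℤ
correction {n} M r t =
  sumℤ (map (λ s →
    (+ numHyperplanes M r s) ℤ.*
    sumℤ (map (λ m →
      sumℤ (map (λ i →
        (-[1+ 0 ] ℤ.^ i) ℤ.*
        + ((s C i) * ((t * (s ∸ r ∸ i) + m + s ∸ 1 ∸ i) C (s ∸ 1))
                   * ((m + n ∸ s ∸ 1) C m)))
        (upTo (suc (s ∸ r)))))
      (upTo t)))
    (map (λ k → r + k) (upTo (n ∸ r))))

{-# OPTIONS --safe #-}

-- The integer points of the t-th dilate of the base polytope are the x in [0,t]^n of total r t
-- with x(H) ≤ (r - 1) t for every hyperplane H. Sufficiency: such an x is a sum of t indicators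
-- of r-sets, and while one of these is a non-basis B₁, contained in a hyperplane H, some other
-- B₂ meets H in at most r - 2 elements; swapping a suitable a ∈ B₁ with b ∈ B₂ \ H turns both
-- into bases. Since distinct hyperplanes meet in at most r - 2 elements, x cannot violate two of
-- the inequalities, so the points lost from the hypersimplex are counted hyperplane by
-- hyperplane. For |H| = s a violator has x(H) = r t - m and total m < t off H: the second part is
-- a free composition of m, and the first, after x ↦ t - x, is a point of [0,t]^s of total
-- t (s - r) + m, counted by inclusion-exclusion.
module Submission where

open import Defs
import Algebra.Properties.CommutativeSemigroup as CommutativeSemigroupProperties
open import Algebra.Bundles using (CommutativeRing)
open import Data.Bool.Base using (Bool; true; false; T; not; _∧_; _∨_; if_then_else_)
open import Data.Bool.ListAction using (any)
open import Data.Bool.Properties using (T?; T-∧; T-∨; T-≡; T-not-≡; ⇔→≡)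
open import Data.Fin.Base using (Fin; zero; suc)
open import Data.Fin.Properties using (any?) renaming (_≟_ to _≟F_)
open import Data.Fin.Subset using (Subset; inside; outside; _∈_; _∉_; _⊆_; _⊂_; ∣_∣; _∩_; _∪_; ∁; ⁅_⁆; ⊤; ⊥)
open import Data.Fin.Subset.Properties using (_∈?_; _⊆?_; anySubset?; drop-there; out⊆; in⊆in; ⊆-refl; ⊆-antisym;
  p⊆q⇒∣p∣≤∣q∣; p⊂q⇒∣p∣<∣q∣; p∩q⊆q; x∈p∩q⁺; x∈p∩q⁻; x∈p∪q⁺; x∈p∪q⁻; x∈⁅x⁆; x∈⁅y⁆⇒x≡y; ∣⁅x⁆∣≡1; ∣p∩q∣≤∣p∣;
  ∩-identityˡ; ∣∁p∣≡n∸∣p∣; ∣p∣≤n; ∣p∣≡n⇒p≡⊤; ∈⊤)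
open import Data.Integer.Base as ℤ using (ℤ; +_; -[1+_]; _-_)
import Data.Integer.Properties as ℤₚ
open import Data.Integer.Tactic.RingSolver using (solve-∀)
open import Data.List.Base using (List; []; _∷_; map; foldr; filter; length; allFin; upTo; _++_; cartesianProductWith)
open import Data.List.Membership.Propositional using (find; lose) renaming (_∈_ to _∈ₗ_)
open import Data.List.Membership.Propositional.Properties using (∈-∃++; ∈-allFin; ∈-filter⁺; ∈-filter⁻; ∈-map⁺; ∈-map⁻;
  ∈-++⁺ˡ; ∈-++⁺ʳ; ∈-upTo⁺; ∈-upTo⁻; ∈-cartesianProductWith⁺; ∈-cartesianProductWith⁻)
import Data.List.Properties as Listₚ
open import Data.List.Relation.Binary.Permutation.Propositional using (_↭_; ↭-trans; prep)
open import Data.List.Relation.Binary.Permutation.Propositional.Properties using (map⁺; All-resp-↭; ↭-length)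
  renaming (shift to ↭-shift)
open import Data.List.Relation.Unary.All as All using (All; []; _∷_)
import Data.List.Relation.Unary.All.Properties as Allₚ
open import Data.List.Relation.Unary.AllPairs using ([]; _∷_)
open import Data.List.Relation.Unary.Any using (here; there)
open import Data.List.Relation.Unary.Any.Properties using (any⁺; any⁻)
open import Data.List.Relation.Unary.Unique.Propositional using (Unique)
import Data.List.Relation.Unary.Unique.Propositional.Properties as Uniqueₚ
open import Data.Nat.Base using (ℕ; zero; suc; _+_; _*_; _∸_; _≤_; _<_; _⊔_; _<ᵇ_; _≡ᵇ_; z≤n; s≤s; >-nonZero)
open import Data.Nat.Combinatorics using (_C_; nCn≡1; nCk≡nC[n∸k]; k>n⇒nCk≡0; nCk+nC[k+1]≡[n+1]C[k+1])
open import Data.Nat.GeneralisedArithmetic using (fold)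
open import Data.Nat.ListAction using (sum)
open import Data.Nat.ListAction.Properties using (sum-↭)
import Data.Nat.Properties as ℕₚ
open import Data.Nat.Tactic.RingSolver using () renaming (solve-∀ to ℕ-solve)
open import Data.Product.Base using (Σ; ∃; _×_; _,_; proj₁; proj₂)
open import Data.Rational.Base as ℚ using (ℚ; 0ℚ; 1ℚ; toℚᵘ)
import Data.Rational.Properties as ℚₚ
open import Data.Rational.Unnormalised.Base as ℚᵘ using (mkℚᵘ; *≡*; *≤*)
import Data.Rational.Unnormalised.Properties as ℚᵘₚ
open import Data.Sum.Base using (_⊎_; inj₁; inj₂)
open import Data.Vec.Base as Vec using (Vec; []; _∷_; lookup; tabulate; _[_]≔_)
open import Data.Vec.Properties using ([]=⇒lookup; lookup⇒[]=; []≔-lookup; []≔-idempotent; []≔-updates; []≔-minimal;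
  lookup∘tabulate; tabulate∘lookup; tabulate-cong; lookup∘update; lookup∘update′; lookup-map; ∷-injective; ∷-injectiveʳ)
open import Data.Vec.Relation.Unary.All as VecAll using ([]; _∷_)
open import Data.Vec.Relation.Unary.All.Properties using (lookup⁺; lookup⁻)
open import Function.Base using (_∘_)
open import Function.Bundles using (Equivalence; mk⇔)
open import Relation.Binary.PropositionalEquality
open import Relation.Nullary using (¬_; Dec; yes; no; contradiction; ¬?; _×-dec_; decidable-stable)

open CommutativeSemigroupProperties ℕₚ.+-commutativeSemigroup using ()
  renaming (interchange to ℕ-interchange; x∙yz≈y∙xz to ℕ-left-comm)
open CommutativeSemigroupProperties (CommutativeRing.+-commutativeSemigroup ℤₚ.+-*-commutativeRing) using ()
  renaming (interchange to ℤ-interchange)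
open CommutativeSemigroupProperties (CommutativeRing.+-commutativeSemigroup ℚₚ.+-*-commutativeRing) using ()
  renaming (interchange to ℚ-interchange)

-- A point of the polytope comes with rational coefficients, and these cannot simply be rounded to a
-- list of bases. They serve only to prove the inequalities, as bounds of linear functionals at the
-- vertices. The converse starts afresh from the lattice point and ends with coefficients all equal
-- to 1. Any decomposition into r-sets will do as a start: a swap preserves the sum of the
-- indicators, and the hyperplane inequalities depend on that sum alone, so they stay available
-- until every set is a basis. The alternating sum of the formula extracts the coefficient of
-- z^(t(s-r)+m) from (1 + z + ... + z^t)^s = (1 - z^(t+1))^s / (1 - z)^s. Its i-th term sits at
-- exponent t(s-r)+m - i(t+1) = t(s-r-i)+m-i. The bound m < t has two effects: it ends the sum at i
-- = s-r, and it makes the upper bound t harmless for the coordinates off H.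

private variable n : ℕ

-- Hyperplanes of a paving matroid

∈-insert⁻ : ∀ {A : Subset n} {x y} → y ∈ A [ x ]≔ inside → y ≡ x ⊎ y ∈ A
∈-insert⁻ {A = A} {x} {y} y∈ with y ≟F x
... | yes y≡x = inj₁ y≡x
... | no y≢x  = inj₂ (lookup⇒[]= y A (trans (sym (lookup∘update′ y≢x A inside)) ([]=⇒lookup y∈)))

∈-remove⁺ : ∀ {A : Subset n} {x y} → y ∈ A → y ≢ x → y ∈ A [ x ]≔ outside
∈-remove⁺ {A = A} {x} {y} y∈A y≢x = []≔-minimal A y x y≢x y∈A

∈-remove⁻ : ∀ {A : Subset n} {x y} → y ∈ A [ x ]≔ outside → y ∈ A × y ≢ x
∈-remove⁻ {A = A} {x} {y} y∈ with y ≟F x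
... | yes refl with () ← trans (sym (lookup∘update x A outside)) ([]=⇒lookup y∈)
... | no y≢x  = lookup⇒[]= y A (trans (sym (lookup∘update′ y≢x A outside)) ([]=⇒lookup y∈)) , y≢x

∉⇒lookup : ∀ {A : Subset n} {x} → x ∉ A → lookup A x ≡ outside
∉⇒lookup {A = A} {x} x∉A with lookup A x in eq
... | inside  = contradiction (lookup⇒[]= x A eq) x∉A
... | outside = refl

insert-∈ : ∀ {A : Subset n} {x} → x ∈ A → A [ x ]≔ inside ≡ A
insert-∈ {A = A} {x} x∈A = trans (cong (A [ x ]≔_) (sym ([]=⇒lookup x∈A))) ([]≔-lookup A x)

remove-insert : ∀ {A : Subset n} {x} → x ∉ A → (A [ x ]≔ inside) [ x ]≔ outside ≡ A
remove-insert {A = A} {x} x∉A = trans ([]≔-idempotent A x)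
  (trans (cong (A [ x ]≔_) (sym (∉⇒lookup x∉A))) ([]≔-lookup A x))

insert-remove : ∀ {A : Subset n} {x} → x ∈ A → (A [ x ]≔ outside) [ x ]≔ inside ≡ A
insert-remove {A = A} {x} x∈A = trans ([]≔-idempotent A x) (insert-∈ x∈A)

∣remove∣ : ∀ {A : Subset n} {x} → x ∈ A → suc ∣ A [ x ]≔ outside ∣ ≡ ∣ A ∣
∣remove∣ {A = inside ∷ A}  {zero}  _   = refl
∣remove∣ {A = inside ∷ A}  {suc x} x∈A = cong suc (∣remove∣ (drop-there x∈A))
∣remove∣ {A = outside ∷ A} {suc x} x∈A = ∣remove∣ (drop-there x∈A)

∣insert∣ : ∀ {A : Subset n} {x} → x ∉ A → ∣ A [ x ]≔ inside ∣ ≡ suc ∣ A ∣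
∣insert∣ {A = A} {x} x∉A = trans (sym (∣remove∣ ([]≔-updates A x))) (cong (suc ∘ ∣_∣) (remove-insert x∉A))

∣p∣<∣q∣⇒∃∈q∖p : ∀ {A B : Subset n} → ∣ A ∣ < ∣ B ∣ → ∃ λ c → c ∈ B × c ∉ A
∣p∣<∣q∣⇒∃∈q∖p {A = A} {B} lt with any? (λ c → (c ∈? B) ×-dec ¬? (c ∈? A))
... | yes found = found
... | no none   = contradiction (p⊆q⇒∣p∣≤∣q∣ B⊆A) (ℕₚ.<⇒≱ lt)
  where
  B⊆A : B ⊆ A
  B⊆A {x} x∈B = decidable-stable (x ∈? A) (λ x∉A → none (x , x∈B , x∉A))

⊆∧∣∣≥⇒⊇ : ∀ {A B : Subset n} → A ⊆ B → ∣ B ∣ ≤ ∣ A ∣ → B ⊆ A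
⊆∧∣∣≥⇒⊇ {A = A} A⊆B le {x} x∈B = decidable-stable (x ∈? A)
  (λ x∉A → ℕₚ.<⇒≱ (p⊂q⇒∣p∣<∣q∣ (A⊆B , x , x∈B , x∉A)) le)

⊆∧∣∣≡suc⇒insert : ∀ {A B : Subset n} → A ⊆ B → ∣ B ∣ ≡ suc ∣ A ∣ → ∃ λ c → c ∉ A × B ≡ A [ c ]≔ inside
⊆∧∣∣≡suc⇒insert {A = A} {B} A⊆B eq with ∣p∣<∣q∣⇒∃∈q∖p {A = A} {B} (ℕₚ.≤-reflexive (sym eq))
... | c , c∈B , c∉A = c , c∉A , ⊆-antisym (⊆∧∣∣≥⇒⊇ sub (ℕₚ.≤-reflexive (trans eq (sym (∣insert∣ c∉A))))) sub
  where
  sub : A [ c ]≔ inside ⊆ B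
  sub x∈ with ∈-insert⁻ x∈
  ... | inj₁ refl = c∈B
  ... | inj₂ x∈A  = A⊆B x∈A

subset-of-size : ∀ (A : Subset n) k → k ≤ ∣ A ∣ → ∃ λ A′ → A′ ⊆ A × ∣ A′ ∣ ≡ k
subset-of-size []            zero    _         = [] , ⊆-refl , refl
subset-of-size (outside ∷ A) k       k≤        with subset-of-size A k k≤
... | A′ , sub , eq = outside ∷ A′ , out⊆ sub , eq
subset-of-size (inside ∷ A)  zero    _         with subset-of-size A zero z≤n
... | A′ , sub , eq = outside ∷ A′ , out⊆ sub , eq
subset-of-size (inside ∷ A)  (suc k) (s≤s k≤)  with subset-of-size A k k≤
... | A′ , sub , eq = inside ∷ A′ , in⊆in sub , cong suc eq

∈-subsets : (A : Subset n) → A ∈ₗ subsets n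
∈-subsets []            = here refl
∈-subsets (outside ∷ A) = ∈-++⁺ˡ (∈-map⁺ (outside ∷_) (∈-subsets A))
∈-subsets (inside ∷ A)  = ∈-++⁺ʳ (map (outside ∷_) (subsets _)) (∈-map⁺ (inside ∷_) (∈-subsets A))

module _ {A : Set} (f : A → ℕ) where
  maximum-≤ : ∀ xs {k} → (∀ {x} → x ∈ₗ xs → f x ≤ k) → foldr _⊔_ 0 (map f xs) ≤ k
  maximum-≤ []       f≤ = z≤n
  maximum-≤ (x ∷ xs) f≤ = ℕₚ.⊔-lub (f≤ (here refl)) (maximum-≤ xs (f≤ ∘ there))

  ≤-maximum : ∀ {xs x} → x ∈ₗ xs → f x ≤ foldr _⊔_ 0 (map f xs)
  ≤-maximum (here refl) = ℕₚ.m≤m⊔n _ _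
  ≤-maximum (there x∈)  = ℕₚ.≤-trans (≤-maximum x∈) (ℕₚ.m≤n⊔m _ _)

  <-maximum⁻ : ∀ xs {k} → k < foldr _⊔_ 0 (map f xs) → ∃ λ x → x ∈ₗ xs × k < f x
  <-maximum⁻ (x ∷ xs) {k} lt with ℕₚ.⊔-sel (f x) (foldr _⊔_ 0 (map f xs))
  ... | inj₁ eq = x , here refl , subst (k <_) eq lt
  ... | inj₂ eq with <-maximum⁻ xs (subst (k <_) eq lt)
  ...   | y , y∈ , k< = y , there y∈ , k<

module _ {A : Set} (p : A → Bool) where
  conjunction⁻ : ∀ {xs x} → T (foldr _∧_ true (map p xs)) → x ∈ₗ xs → T (p x)
  conjunction⁻ t (here refl) = proj₁ (Equivalence.to T-∧ t)
  conjunction⁻ {y ∷ _} t (there x∈) = conjunction⁻ (proj₂ (Equivalence.to (T-∧ {p y}) t)) x∈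

  conjunction⁺ : ∀ xs → (∀ x → T (p x)) → T (foldr _∧_ true (map p xs))
  conjunction⁺ []       all = _
  conjunction⁺ (x ∷ xs) all = Equivalence.from T-∧ (all x , conjunction⁺ xs all)

module _ (M : Matroid n) where

  Basis : Subset n → Set
  Basis B = T (isBasis M B)

  Independent? : ∀ A → Dec (Independent M A)
  Independent? A = anySubset? (λ B → T? (isBasis M B) ×-dec (A ⊆? B))

  rk-≤ : ∀ A {k} → (∀ B → Basis B → ∣ A ∩ B ∣ ≤ k) → rk M A ≤ k
  rk-≤ A le = maximum-≤ (λ B → ∣ A ∩ B ∣) (bases M)
    (λ {B} B∈ → le B (proj₂ (∈-filter⁻ (T? ∘ isBasis M) {xs = subsets n} B∈)))

  ≤-rk : ∀ A {B} → Basis B → ∣ A ∩ B ∣ ≤ rk M A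
  ≤-rk A {B} b = ≤-maximum (λ B → ∣ A ∩ B ∣) (∈-filter⁺ (T? ∘ isBasis M) (∈-subsets B) b)

  <-rk⁻ : ∀ A {k} → k < rk M A → ∃ λ B → Basis B × k < ∣ A ∩ B ∣
  <-rk⁻ A lt with <-maximum⁻ (λ B → ∣ A ∩ B ∣) (bases M) lt
  ... | B , B∈ , k< = B , proj₂ (∈-filter⁻ (T? ∘ isBasis M) {xs = subsets n} B∈) , k<

  -- Discard elements as long as the set stays dependent; when no element can be discarded, every
  -- proper subset is independent. The bound `k` on the size drives the recursion.
  dependent⇒circuit : ∀ k A → ∣ A ∣ ≤ k → ¬ Independent M A → ∃ λ K → Circuit M K × K ⊆ A
  dependent⇒circuit k A ∣A∣≤k dep with any? (λ x → (x ∈? A) ×-dec ¬? (Independent? (A [ x ]≔ outside)))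
  dependent⇒circuit k A ∣A∣≤k dep | no none = A , (dep , proper) , ⊆-refl
    where
    proper : ∀ D → D ⊂ A → Independent M D
    proper D (D⊆A , x , x∈A , x∉D)
      with decidable-stable (Independent? (A [ x ]≔ outside)) (λ ¬ind → none (x , x∈A , ¬ind))
    ... | B , b , A-x⊆B = B , b , λ {y} y∈D → A-x⊆B (∈-remove⁺ (D⊆A y∈D) (λ { refl → x∉D y∈D }))
  dependent⇒circuit zero A ∣A∣≤k dep | yes (x , x∈A , _) with () ← ℕₚ.≤-trans (ℕₚ.≤-reflexive (∣remove∣ x∈A)) ∣A∣≤k
  dependent⇒circuit (suc k) A ∣A∣≤k dep | yes (x , x∈A , dep′)
    with dependent⇒circuit k (A [ x ]≔ outside) (ℕₚ.≤-pred (ℕₚ.≤-trans (ℕₚ.≤-reflexive (∣remove∣ x∈A)) ∣A∣≤k)) dep′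
  ... | K , circ , K⊆ = K , circ , proj₁ ∘ ∈-remove⁻ ∘ K⊆

  -- For a set of r - 1 elements, all independent in a paving matroid, this is the matroid closure.
  -- Elements of `A` itself belong to it because inserting them leaves a set too small to be a
  -- basis.
  cl : Subset n → Subset n
  cl A = tabulate (λ x → not (isBasis M (A [ x ]≔ inside)))

  ∈-cl⁺ : ∀ {A x} → ¬ Basis (A [ x ]≔ inside) → x ∈ cl A
  ∈-cl⁺ {A} {x} ¬b = lookup⇒[]= x (cl A) (trans (lookup∘tabulate _ x) (lemma _ ¬b))
    where
    lemma : ∀ b → ¬ T b → not b ≡ inside
    lemma true  ¬t = contradiction _ ¬t
    lemma false _  = refl

  ∈-cl⁻ : ∀ {A x} → x ∈ cl A → ¬ Basis (A [ x ]≔ inside)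
  ∈-cl⁻ {A} {x} x∈ b = lemma _ b (trans (sym (lookup∘tabulate _ x)) ([]=⇒lookup x∈))
    where
    lemma : ∀ b → T b → not b ≢ inside
    lemma true _ ()

  module _ {r : ℕ} (rank : HasRank M r) where

    Hyperplane : Subset n → Set
    Hyperplane H = T (isHyperplane M r H)

    hyperplane⇒rk : ∀ H → Hyperplane H → suc (rk M H) ≡ r
    hyperplane⇒rk H h = ℕₚ.≡ᵇ⇒≡ _ r (proj₂ (Equivalence.to (T-∧ {isFlat M H}) h))

    hyperplane⇒∣∩∣< : ∀ H → Hyperplane H → ∀ {B} → Basis B → ∣ H ∩ B ∣ < r
    hyperplane⇒∣∩∣< H h b = subst (_ <_) (hyperplane⇒rk H h) (s≤s (≤-rk H b))

    hyperplane⇒basis⊈ : ∀ H → Hyperplane H → ∀ {B} → Basis B → ¬ B ⊆ H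
    hyperplane⇒basis⊈ H h {B} b B⊆H = ℕₚ.<⇒≱ (hyperplane⇒∣∩∣< H h b)
      (subst (_≤ _) (rank B b) (p⊆q⇒∣p∣≤∣q∣ (λ x∈B → x∈p∩q⁺ (B⊆H x∈B , x∈B))))

    -- Flatness of `H` makes the rank rise from r - 1 when `b` is added, so some basis has at least
    -- r elements in the enlarged set, which is all of them.
    hyperplane⇒basis⊆insert : ∀ H → Hyperplane H → ∀ {b} → b ∉ H → ∃ λ B → Basis B × B ⊆ H ∪ ⁅ b ⁆
    hyperplane⇒basis⊆insert H h {b} b∉H
      with Equivalence.to (T-∨ {lookup H b}) (conjunction⁻ _ (proj₁ (Equivalence.to (T-∧ {isFlat M H}) h)) (∈-allFin b))
    ... | inj₁ t with () ← subst T (∉⇒lookup b∉H) t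
    ... | inj₂ t with <-rk⁻ (H ∪ ⁅ b ⁆) (ℕₚ.<ᵇ⇒< _ _ t)
    ...   | B , β , lt = B , β , proj₁ ∘ x∈p∩q⁻ (H ∪ ⁅ b ⁆) B ∘
      ⊆∧∣∣≥⇒⊇ (p∩q⊆q (H ∪ ⁅ b ⁆) B) (ℕₚ.≤-trans (ℕₚ.≤-reflexive (trans (rank B β) (sym (hyperplane⇒rk H h)))) lt)

    module _ (paving : Paving M r) where

      -- A dependent set contains a circuit, and circuits have at least r elements. The paving
      -- hypothesis enters the proof through this lemma.
      ∣∣<r⇒independent : ∀ A → ∣ A ∣ < r → Independent M A
      ∣∣<r⇒independent A lt = decidable-stable (Independent? A) λ dep →
        let K , circ , K⊆A = dependent⇒circuit ∣ A ∣ A ℕₚ.≤-refl dep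
        in ℕₚ.<⇒≱ lt (ℕₚ.≤-trans (paving K circ) (p⊆q⇒∣p∣≤∣q∣ K⊆A))

      -- `A` is independent and one element short, so some `A` + c is a basis. If c is not in `B`,
      -- exchanging it against `B` replaces it by an element of `B` and leaves `A` untouched.
      augment : ∀ {A B} → suc ∣ A ∣ ≡ r → Basis B → ∃ λ y → y ∈ B × y ∉ A × Basis (A [ y ]≔ inside)
      augment {A} {B} ∣A∣ β with ∣∣<r⇒independent A (ℕₚ.≤-reflexive ∣A∣)
      ... | B′ , β′ , A⊆B′ with ⊆∧∣∣≡suc⇒insert A⊆B′ (trans (rank B′ β′) (sym ∣A∣))
      ...   | c , c∉A , refl with c ∈? B
      ...     | yes c∈B = c , c∈B , c∉A , β′
      ...     | no c∉B with exchange M (A [ c ]≔ inside) B β′ β c ([]≔-updates A c) c∉B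
      ...       | y , y∈B , y∉B′ , β″ =
        y , y∈B , y∉B′ ∘ A⊆B′ , subst (λ D → Basis (D [ y ]≔ inside)) (remove-insert c∉A) β″

      hyperplane-∈⇒nonbasis : ∀ {A} H → Hyperplane H → A ⊆ H → ∀ {x} → x ∈ H → ¬ Basis (A [ x ]≔ inside)
      hyperplane-∈⇒nonbasis {A} H h A⊆H {x} x∈H β = hyperplane⇒basis⊈ H h β sub
        where
        sub : A [ x ]≔ inside ⊆ H
        sub y∈ with ∈-insert⁻ y∈
        ... | inj₁ refl = x∈H
        ... | inj₂ y∈A  = A⊆H y∈A

      -- Augment `A` from a basis inside `H` + x. The new element cannot lie in `H`, since a
      -- hyperplane contains no basis, so it is `x`.
      hyperplane-∉⇒basis : ∀ {A} H → Hyperplane H → suc ∣ A ∣ ≡ r → A ⊆ H → ∀ {x} → x ∉ H → Basis (A [ x ]≔ inside)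
      hyperplane-∉⇒basis {A} H h ∣A∣ A⊆H {x} x∉H with hyperplane⇒basis⊆insert H h x∉H
      ... | B , β , B⊆ with augment ∣A∣ β
      ...   | y , y∈B , y∉A , β′ with x∈p∪q⁻ H ⁅ x ⁆ (B⊆ y∈B)
      ...     | inj₁ y∈H = contradiction β′ (hyperplane-∈⇒nonbasis H h A⊆H y∈H)
      ...     | inj₂ y∈x with refl ← x∈⁅y⁆⇒x≡y x y∈x = β′

      ⊆-cl : ∀ {A} → suc ∣ A ∣ ≡ r → A ⊆ cl A
      ⊆-cl {A} ∣A∣ {x} x∈A = ∈-cl⁺ λ β →
        ℕₚ.1+n≢n (trans ∣A∣ (trans (sym (rank _ β)) (cong ∣_∣ (insert-∈ x∈A))))

      -- A basis with r elements in `cl A` would lie inside it, and augmenting `A` from that basis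
      -- would pick an element of `cl A` that completes `A` to a basis. So the rank is r - 1. An `x`
      -- outside makes `A` + x a basis, which raises the rank and gives flatness.
      cl-hyperplane : ∀ {A} → suc ∣ A ∣ ≡ r → Hyperplane (cl A)
      cl-hyperplane {A} ∣A∣ = Equivalence.from T-∧ (conjunction⁺ _ (allFin _) flat , ℕₚ.≡⇒≡ᵇ _ r (trans (cong suc rk≡) ∣A∣))
        where
        below : ∀ B → Basis B → ∣ cl A ∩ B ∣ ≤ ∣ A ∣
        below B β = ℕₚ.≮⇒≥ λ lt →
          let y , y∈B , _ , β′ = augment ∣A∣ β
              B⊆ = ⊆∧∣∣≥⇒⊇ (p∩q⊆q (cl A) B) (ℕₚ.≤-trans (ℕₚ.≤-reflexive (trans (rank B β) (sym ∣A∣))) lt)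
          in ∈-cl⁻ (proj₁ (x∈p∩q⁻ (cl A) B (B⊆ y∈B))) β′
        ∣A∣≤rk : ∣ A ∣ ≤ rk M (cl A)
        ∣A∣≤rk with ∣∣<r⇒independent A (ℕₚ.≤-reflexive ∣A∣)
        ... | B , β , A⊆B = ℕₚ.≤-trans (p⊆q⇒∣p∣≤∣q∣ (λ x∈A → x∈p∩q⁺ (⊆-cl ∣A∣ x∈A , A⊆B x∈A))) (≤-rk (cl A) β)
        rk≡ : rk M (cl A) ≡ ∣ A ∣
        rk≡ = ℕₚ.≤-antisym (rk-≤ (cl A) below) ∣A∣≤rk
        flat : ∀ x → T (lookup (cl A) x ∨ (rk M (cl A) <ᵇ rk M (cl A ∪ ⁅ x ⁆)))
        flat x with x ∈? cl A
        ... | yes x∈ = Equivalence.from (T-∨ {lookup (cl A) x}) (inj₁ (Equivalence.from T-≡ ([]=⇒lookup x∈)))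
        ... | no x∉  = Equivalence.from (T-∨ {lookup (cl A) x}) (inj₂ (ℕₚ.<⇒<ᵇ (ℕₚ.≤-trans (s≤s (ℕₚ.≤-reflexive rk≡)) bigger)))
          where
          β : Basis (A [ x ]≔ inside)
          β = decidable-stable (T? _) (x∉ ∘ ∈-cl⁺)
          sub : A [ x ]≔ inside ⊆ cl A ∪ ⁅ x ⁆
          sub y∈ with ∈-insert⁻ y∈
          ... | inj₁ refl = x∈p∪q⁺ (inj₂ (x∈⁅x⁆ x))
          ... | inj₂ y∈A  = x∈p∪q⁺ (inj₁ (⊆-cl ∣A∣ y∈A))
          bigger : suc ∣ A ∣ ≤ rk M (cl A ∪ ⁅ x ⁆)
          bigger = ℕₚ.≤-trans (ℕₚ.≤-reflexive (trans ∣A∣ (sym (rank _ β))))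
            (ℕₚ.≤-trans (p⊆q⇒∣p∣≤∣q∣ (λ y∈ → x∈p∩q⁺ (sub y∈ , y∈))) (≤-rk (cl A ∪ ⁅ x ⁆) β))

      -- Any r - 1 elements `A` of a hyperplane determine it: `x` belongs to it exactly when `A` + x
      -- is not a basis. Two hyperplanes sharing such an `A` therefore coincide.
      hyperplane-unique : ∀ H H′ → Hyperplane H → Hyperplane H′ → r ≤ suc ∣ H ∩ H′ ∣ → H ≡ H′
      hyperplane-unique H H′ h h′ r≤
        with subset-of-size (H ∩ H′) (rk M H) (ℕₚ.≤-pred (ℕₚ.≤-trans (ℕₚ.≤-reflexive (hyperplane⇒rk H h)) r≤))
      ... | A , A⊆ , eq = ⊆-antisym (half H′ h′ (proj₂ ∘ A⊆∩) H h (proj₁ ∘ A⊆∩)) (half H h (proj₁ ∘ A⊆∩) H′ h′ (proj₂ ∘ A⊆∩))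
        where
        A⊆∩ : ∀ {x} → x ∈ A → x ∈ H × x ∈ H′
        A⊆∩ x∈A = x∈p∩q⁻ H H′ (A⊆ x∈A)
        ∣A∣ : suc ∣ A ∣ ≡ r
        ∣A∣ = trans (cong suc eq) (hyperplane⇒rk H h)
        half : ∀ K → Hyperplane K → A ⊆ K → ∀ K′ → Hyperplane K′ → A ⊆ K′ → K′ ⊆ K
        half K κ A⊆K K′ κ′ A⊆K′ {x} x∈K′ = decidable-stable (x ∈? K) λ x∉K →
          hyperplane-∈⇒nonbasis K′ κ′ A⊆K′ x∈K′ (hyperplane-∉⇒basis K κ ∣A∣ A⊆K x∉K)

      -- Remove some `a` from `B`. The closure of the rest contains `a` again, precisely because `B`
      -- is not a basis.
      nonbasis⊆hyperplane : ∀ {B} → ∣ B ∣ ≡ r → ¬ Basis B → ∃ λ H → Hyperplane H × B ⊆ H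
      nonbasis⊆hyperplane {B} ∣B∣ ¬β with any? (_∈? B)
      -- An empty `B` lies in the basis `B₀` and has the same size r = 0, so it would be that basis.
      ... | no empty = contradiction (subst Basis (sym B≡B₀) β₀) ¬β
        where
        B₀ = proj₁ (nonempty M)
        β₀ = proj₂ (nonempty M)
        B⊆B₀ : B ⊆ B₀
        B⊆B₀ {x} x∈B = contradiction (x , x∈B) empty
        B≡B₀ : B ≡ B₀
        B≡B₀ = ⊆-antisym B⊆B₀ (⊆∧∣∣≥⇒⊇ B⊆B₀ (ℕₚ.≤-reflexive (trans (rank B₀ β₀) (sym ∣B∣))))
      ... | yes (a , a∈B) = cl A , cl-hyperplane ∣A∣ , sub
        where
        A = B [ a ]≔ outside
        ∣A∣ : suc ∣ A ∣ ≡ r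
        ∣A∣ = trans (∣remove∣ a∈B) ∣B∣
        sub : B ⊆ cl A
        sub {x} x∈B with x ≟F a
        ... | yes refl = ∈-cl⁺ (subst (¬_ ∘ Basis) (sym (insert-remove a∈B)) ¬β)
        ... | no x≢a   = ⊆-cl ∣A∣ (∈-remove⁺ x∈B x≢a)

      -- If no a worked, the hyperplane spanned by B₂ - b would contain B₁, hence equal H and meet
      -- B₂ in r - 1 elements.
      exchange-out-of-hyperplane : ∀ {B₁ B₂} H → Hyperplane H → ∣ B₁ ∣ ≡ r → B₁ ⊆ H → ∣ B₂ ∣ ≡ r → 2 + ∣ H ∩ B₂ ∣ ≤ r →
        ∃ λ a → ∃ λ b → (a ∈ B₁ × a ∉ B₂) × (b ∈ B₂ × b ∉ B₁) ×
          Basis ((B₁ [ a ]≔ outside) [ b ]≔ inside) × Basis ((B₂ [ b ]≔ outside) [ a ]≔ inside)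
      exchange-out-of-hyperplane {B₁} {B₂} H h ∣B₁∣ B₁⊆H ∣B₂∣ small
        with ∣p∣<∣q∣⇒∃∈q∖p {A = H ∩ B₂} {B₂} (ℕₚ.≤-trans (ℕₚ.≤-trans (ℕₚ.n≤1+n _) small) (ℕₚ.≤-reflexive (sym ∣B₂∣)))
      ... | b , b∈B₂ , b∉∩ with any? (λ a → (a ∈? B₁) ×-dec T? (isBasis M ((B₂ [ b ]≔ outside) [ a ]≔ inside)))
      ...   | yes (a , a∈B₁ , β₂) = a , b , (a∈B₁ , a∉B₂) , (b∈B₂ , b∉H ∘ B₁⊆H) ,
        hyperplane-∉⇒basis H h (trans (∣remove∣ a∈B₁) ∣B₁∣) (B₁⊆H ∘ proj₁ ∘ ∈-remove⁻) b∉H , β₂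
        where
        b∉H : b ∉ H
        b∉H b∈H = b∉∩ (x∈p∩q⁺ (b∈H , b∈B₂))
        a∉B₂ : a ∉ B₂
        a∉B₂ a∈B₂ = ∈-cl⁻ (⊆-cl (trans (∣remove∣ b∈B₂) ∣B₂∣) (∈-remove⁺ a∈B₂ (λ { refl → b∉H (B₁⊆H a∈B₁) }))) β₂
      ...   | no none = contradiction small (ℕₚ.<⇒≱ (s≤s r≤))
        where
        A₂ = B₂ [ b ]≔ outside
        ∣A₂∣ : suc ∣ A₂ ∣ ≡ r
        ∣A₂∣ = trans (∣remove∣ b∈B₂) ∣B₂∣
        B₁⊆cl : B₁ ⊆ cl A₂
        B₁⊆cl {a} a∈B₁ = ∈-cl⁺ (λ β → none (a , a∈B₁ , β))
        H≡cl : H ≡ cl A₂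
        H≡cl = hyperplane-unique H (cl A₂) h (cl-hyperplane ∣A₂∣)
          (ℕₚ.m≤n⇒m≤1+n (subst (_≤ ∣ H ∩ cl A₂ ∣) ∣B₁∣ (p⊆q⇒∣p∣≤∣q∣ (λ x∈ → x∈p∩q⁺ (B₁⊆H x∈ , B₁⊆cl x∈)))))
        r≤ : r ≤ suc ∣ H ∩ B₂ ∣
        r≤ = subst (_≤ _) ∣A₂∣ (s≤s (p⊆q⇒∣p∣≤∣q∣ λ x∈ →
          x∈p∩q⁺ (subst (_ ∈_) (sym H≡cl) (⊆-cl ∣A₂∣ x∈) , proj₁ (∈-remove⁻ x∈))))

-- Decomposition of lattice points into bases

Bounded : ℕ → Vec ℕ n → Set
Bounded t = VecAll.All (_≤ t)

weight : Subset n → Vec ℕ n → ℕ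
weight []            []      = 0
weight (inside ∷ A)  (v ∷ x) = v + weight A x
weight (outside ∷ A) (v ∷ x) = weight A x

deficit : ℕ → Subset n → Vec ℕ n → ℕ
deficit t A x = weight A (Vec.map (t ∸_) x)

deficit+weight : ∀ {t} (A : Subset n) {x : Vec ℕ n} → Bounded t x → deficit t A x + weight A x ≡ ∣ A ∣ * t
deficit+weight []            []        = refl
deficit+weight (outside ∷ A) (_ ∷ x≤)  = deficit+weight A x≤
deficit+weight {t = t} (inside ∷ A) {v ∷ x} (v≤ ∷ x≤) =
  trans (ℕ-interchange (t ∸ v) (deficit t A x) v (weight A x)) (cong₂ _+_ (ℕₚ.m∸n+n≡m v≤) (deficit+weight A x≤))

weight-≤ : ∀ {t} (A : Subset n) {x : Vec ℕ n} → Bounded t x → weight A x ≤ ∣ A ∣ * t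
weight-≤ A {x} x≤ = subst (weight A x ≤_) (deficit+weight A x≤) (ℕₚ.m≤n+m _ _)

weight+weight-∁ : (A : Subset n) (x : Vec ℕ n) → weight A x + weight (∁ A) x ≡ Vec.sum x
weight+weight-∁ []            []      = refl
weight+weight-∁ (inside ∷ A)  (v ∷ x) = trans (ℕₚ.+-assoc v _ _) (cong₂ _+_ refl (weight+weight-∁ A x))
weight+weight-∁ (outside ∷ A) (v ∷ x) = trans (ℕ-left-comm (weight A x) v (weight (∁ A) x)) (cong₂ _+_ refl (weight+weight-∁ A x))

weight-∪-∩ : (A B : Subset n) (x : Vec ℕ n) → weight A x + weight B x ≡ weight (A ∪ B) x + weight (A ∩ B) x
weight-∪-∩ []            []            []      = refl
weight-∪-∩ (outside ∷ A) (outside ∷ B) (v ∷ x) = weight-∪-∩ A B x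
weight-∪-∩ (inside ∷ A)  (outside ∷ B) (v ∷ x) = trans (ℕₚ.+-assoc v _ _)
  (trans (cong₂ _+_ (refl {x = v}) (weight-∪-∩ A B x)) (sym (ℕₚ.+-assoc v _ _)))
weight-∪-∩ (outside ∷ A) (inside ∷ B)  (v ∷ x) = trans (ℕ-left-comm (weight A x) v (weight B x))
  (trans (cong₂ _+_ (refl {x = v}) (weight-∪-∩ A B x)) (sym (ℕₚ.+-assoc v _ _)))
weight-∪-∩ (inside ∷ A)  (inside ∷ B)  (v ∷ x) = trans (ℕ-interchange v (weight A x) v (weight B x))
  (trans (cong₂ _+_ (refl {x = v + v}) (weight-∪-∩ A B x)) (ℕ-interchange v v (weight (A ∪ B) x) (weight (A ∩ B) x)))

weight-≤-sum : (A : Subset n) (x : Vec ℕ n) → weight A x ≤ Vec.sum x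
weight-≤-sum A x = subst (weight A x ≤_) (weight+weight-∁ A x) (ℕₚ.m≤m+n _ _)

-- By modularity x(A) + x(B) = x(A ∪ B) + x(A ∩ B), which is at most r t + (r - 2) t. Two violated
-- hyperplane inequalities would sum to strictly more.
overlap-bound : ∀ {r t} (A B : Subset n) {x : Vec ℕ n} → Bounded t x → Vec.sum x ≡ r * t → 2 + ∣ A ∩ B ∣ ≤ r →
  (weight A x + t) + (weight B x + t) ≤ r * t + r * t
overlap-bound {r = r} {t} A B {x} x≤ sum≡ small = begin
  (weight A x + t) + (weight B x + t)                    ≡⟨ ℕ-interchange (weight A x) t (weight B x) t ⟩
  weight A x + weight B x + (t + t)                      ≡⟨ cong (_+ (t + t)) (weight-∪-∩ A B x) ⟩
  weight (A ∪ B) x + weight (A ∩ B) x + (t + t)          ≤⟨ ℕₚ.+-monoˡ-≤ (t + t) (ℕₚ.+-mono-≤ (weight-≤-sum (A ∪ B) x) (weight-≤ (A ∩ B) x≤)) ⟩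
  Vec.sum x + ∣ A ∩ B ∣ * t + (t + t)                    ≡⟨ collect (Vec.sum x) ∣ A ∩ B ∣ t ⟩
  Vec.sum x + (2 + ∣ A ∩ B ∣) * t                        ≤⟨ ℕₚ.+-mono-≤ (ℕₚ.≤-reflexive sum≡) (ℕₚ.*-monoˡ-≤ t small) ⟩
  r * t + r * t                                          ∎
  where
  open ℕₚ.≤-Reasoning
  collect : ∀ u i t → u + i * t + (t + t) ≡ u + (2 + i) * t
  collect = ℕ-solve

indicatorℕ : Subset n → Fin n → ℕ
indicatorℕ B i = if lookup B i then 1 else 0

sumOver : {A : Set} → (A → ℕ) → List A → ℕ
sumOver f xs = sum (map f xs)

sumOver-↭ : {A : Set} (f : A → ℕ) {xs ys : List A} → xs ↭ ys → sumOver f xs ≡ sumOver f ys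
sumOver-↭ f p = sum-↭ (map⁺ f p)

multiplicity : List (Subset n) → Fin n → ℕ
multiplicity Bs i = sumOver (λ B → indicatorℕ B i) Bs

∈⇒↭∷ : {A : Set} {x : A} {xs : List A} → x ∈ₗ xs → ∃ λ ys → xs ↭ x ∷ ys
∈⇒↭∷ {x = x} x∈ with ∈-∃++ x∈
... | ys , zs , refl = _ , ↭-shift x ys zs

count≥ : ℕ → Vec ℕ n → ℕ
count≥ k [] = 0
count≥ k (v ∷ x) with k ℕₚ.≤? v
... | yes _ = suc (count≥ k x)
... | no _  = count≥ k x

count≥-antitone : ∀ {j k} → j ≤ k → (x : Vec ℕ n) → count≥ k x ≤ count≥ j x
count≥-antitone j≤k [] = z≤n
count≥-antitone {j = j} {k} j≤k (v ∷ x) with k ℕₚ.≤? v | j ℕₚ.≤? v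
... | yes _   | yes _  = s≤s (count≥-antitone j≤k x)
... | yes k≤v | no j≰v = contradiction (ℕₚ.≤-trans j≤k k≤v) j≰v
... | no _    | yes _  = ℕₚ.m≤n⇒m≤1+n (count≥-antitone j≤k x)
... | no _    | no _   = count≥-antitone j≤k x

count≥*≤sum : ∀ k (x : Vec ℕ n) → count≥ k x * k ≤ Vec.sum x
count≥*≤sum k [] = z≤n
count≥*≤sum k (v ∷ x) with k ℕₚ.≤? v
... | yes k≤v = ℕₚ.+-mono-≤ k≤v (count≥*≤sum k x)
... | no _    = ℕₚ.m≤n⇒m≤o+n v (count≥*≤sum k x)

sum≤count≥1* : ∀ k (x : Vec ℕ n) → Bounded k x → Vec.sum x ≤ count≥ 1 x * k
sum≤count≥1* k [] [] = z≤n
sum≤count≥1* k (zero ∷ x)  (_ ∷ x≤)   = sum≤count≥1* k x x≤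
sum≤count≥1* k (suc v ∷ x) (v≤ ∷ x≤)  = ℕₚ.+-mono-≤ v≤ (sum≤count≥1* k x x≤)

-- Subtracting the indicator of `B` must bring every coordinate down to at most t and none below 0,
-- so `B` has to contain the coordinates equal to t + 1 and stay within the support. The two count
-- hypotheses say that r lies between these sizes. The scan skips an optional coordinate as long as
-- the tail can still supply r elements.
peel : ∀ t r (x : Vec ℕ n) → Bounded (suc t) x → count≥ (suc t) x ≤ r → r ≤ count≥ 1 x →
       ∃ λ B → ∃ λ y → ∣ B ∣ ≡ r × Bounded t y × (∀ i → indicatorℕ B i + lookup y i ≡ lookup x i) × r + Vec.sum y ≡ Vec.sum x
peel t zero    []         []       _     _  = [] , [] , refl , [] , (λ ()) , refl
peel t r       (zero ∷ x) (_ ∷ x≤) full≤ ≤support with peel t r x x≤ full≤ ≤support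
... | B , y , ∣B∣ , y≤ , eq , sum≡ = outside ∷ B , zero ∷ y , ∣B∣ , z≤n ∷ y≤ , (λ { zero → refl ; (suc i) → eq i }) , sum≡
peel t r (suc v ∷ x) (s≤s v≤t ∷ x≤) full≤ ≤support with suc t ℕₚ.≤? suc v
peel t (suc r) (suc v ∷ x) (s≤s v≤t ∷ x≤) (s≤s full≤) (s≤s ≤support) | yes t≤v with peel t r x x≤ full≤ ≤support
... | B , y , ∣B∣ , y≤ , eq , sum≡ =
  inside ∷ B , v ∷ y , cong suc ∣B∣ , v≤t ∷ y≤ , (λ { zero → refl ; (suc i) → eq i }) , cong suc (trans (ℕ-left-comm r v (Vec.sum y)) (cong₂ _+_ (refl {x = v}) sum≡))
peel t r (suc v ∷ x) (s≤s v≤t ∷ x≤) full≤ ≤support | no t≰v with r ℕₚ.≤? count≥ 1 x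
... | yes r≤ with peel t r x x≤ full≤ r≤
...   | B , y , ∣B∣ , y≤ , eq , sum≡ =
  outside ∷ B , suc v ∷ y , ∣B∣ , ℕₚ.≤-pred (ℕₚ.≰⇒> t≰v) ∷ y≤ , (λ { zero → refl ; (suc i) → eq i }) , trans (ℕ-left-comm r (suc v) (Vec.sum y)) (cong₂ _+_ (refl {x = suc v}) sum≡)
peel t zero    (suc v ∷ x) (s≤s v≤t ∷ x≤) full≤ ≤support | no t≰v | no r≰ = contradiction z≤n r≰
-- The tail has at most r nonzero coordinates, hence at most r full ones, so taking this coordinate
-- leaves a feasible problem for r.
peel t (suc r) (suc v ∷ x) (s≤s v≤t ∷ x≤) full≤ ≤support | no t≰v | no r≰
  with peel t r x x≤ (ℕₚ.≤-trans (count≥-antitone (s≤s z≤n) x) (ℕₚ.≤-pred (ℕₚ.≰⇒> r≰))) (ℕₚ.≤-pred ≤support)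
... | B , y , ∣B∣ , y≤ , eq , sum≡ =
  inside ∷ B , v ∷ y , cong suc ∣B∣ , v≤t ∷ y≤ , (λ { zero → refl ; (suc i) → eq i }) , cong suc (trans (ℕ-left-comm r v (Vec.sum y)) (cong₂ _+_ (refl {x = v}) sum≡))

-- The total r (t + 1) allows at most r coordinates equal to t + 1. As no coordinate exceeds t + 1,
-- it also forces at least r nonzero ones. So `peel` applies at every level.
uniform-decomposition : ∀ t r (x : Vec ℕ n) → Bounded t x → Vec.sum x ≡ r * t →
  ∃ λ Bs → length Bs ≡ t × All (λ B → ∣ B ∣ ≡ r) Bs × (∀ i → multiplicity Bs i ≡ lookup x i)
uniform-decomposition zero    r x x≤ sum≡ = [] , refl , [] , λ i → sym (ℕₚ.n≤0⇒n≡0 (lookup⁺ x≤ i))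
uniform-decomposition (suc t) r x x≤ sum≡
  with peel t r x x≤
    (ℕₚ.*-cancelʳ-≤ _ r (suc t) (subst (count≥ (suc t) x * suc t ≤_) sum≡ (count≥*≤sum (suc t) x)))
    (ℕₚ.*-cancelʳ-≤ r _ (suc t) (subst (_≤ count≥ 1 x * suc t) sum≡ (sum≤count≥1* (suc t) x x≤)))
... | B , y , ∣B∣ , y≤ , eq , sum′
  with uniform-decomposition t r y y≤ (ℕₚ.+-cancelˡ-≡ r _ _ (trans sum′ (trans sum≡ (ℕₚ.*-suc r t))))
... | Bs , len , sizes , mult = B ∷ Bs , cong suc len , ∣B∣ ∷ sizes , λ i → trans (cong₂ _+_ refl (mult i)) (eq i)

weight-+ : (A : Subset n) (f g : Fin n → ℕ) →
  weight A (tabulate (λ i → f i + g i)) ≡ weight A (tabulate f) + weight A (tabulate g)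
weight-+ []            f g = refl
weight-+ (outside ∷ A) f g = weight-+ A (f ∘ suc) (g ∘ suc)
weight-+ (inside ∷ A)  f g rewrite weight-+ A (f ∘ suc) (g ∘ suc) = ℕ-interchange (f zero) (g zero) _ _

weight-zero : (A : Subset n) → weight A (tabulate (λ _ → 0)) ≡ 0
weight-zero []            = refl
weight-zero (inside ∷ A)  = weight-zero A
weight-zero (outside ∷ A) = weight-zero A

weight-indicator : (A B : Subset n) → weight A (tabulate (indicatorℕ B)) ≡ ∣ A ∩ B ∣
weight-indicator []            []            = refl
weight-indicator (inside ∷ A)  (inside ∷ B)  = cong suc (weight-indicator A B)
weight-indicator (inside ∷ A)  (outside ∷ B) = weight-indicator A B
weight-indicator (outside ∷ A) (_ ∷ B)       = weight-indicator A B

weight-multiplicity : (A : Subset n) (Bs : List (Subset n)) →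
  weight A (tabulate (multiplicity Bs)) ≡ sumOver (λ B → ∣ A ∩ B ∣) Bs
weight-multiplicity A []       = weight-zero A
weight-multiplicity A (B ∷ Bs) = trans (weight-+ A (indicatorℕ B) (multiplicity Bs))
  (cong₂ _+_ (weight-indicator A B) (weight-multiplicity A Bs))

sumOver-suc : {A : Set} (f : A → ℕ) (xs : List A) → sumOver (suc ∘ f) xs ≡ sumOver f xs + length xs
sumOver-suc f []       = refl
sumOver-suc f (x ∷ xs) rewrite sumOver-suc f xs = rearr (f x) (sumOver f xs) (length xs)
  where
  rearr : ∀ a b c → suc a + (b + c) ≡ a + b + suc c
  rearr = ℕ-solve

length*≤sumOver : {A : Set} (f : A → ℕ) {xs : List A} {k : ℕ} → All (λ x → k ≤ f x) xs → k * length xs ≤ sumOver f xs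
length*≤sumOver f {k = k} []        = ℕₚ.≤-reflexive (ℕₚ.*-zeroʳ k)
length*≤sumOver f {x ∷ xs} {k} (k≤ ∷ all) = ℕₚ.≤-trans (ℕₚ.≤-reflexive (ℕₚ.*-suc k (length xs))) (ℕₚ.+-mono-≤ k≤ (length*≤sumOver f all))

indicator-exchange : ∀ {B₁ B₂ : Subset n} {a b} → a ∈ B₁ → a ∉ B₂ → b ∈ B₂ → b ∉ B₁ → ∀ i →
  indicatorℕ ((B₁ [ a ]≔ outside) [ b ]≔ inside) i + indicatorℕ ((B₂ [ b ]≔ outside) [ a ]≔ inside) i
    ≡ indicatorℕ B₁ i + indicatorℕ B₂ i
indicator-exchange {B₁ = B₁} {B₂} {a} {b} a∈B₁ a∉B₂ b∈B₂ b∉B₁ i with i ≟F a | i ≟F b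
... | yes refl | yes refl = contradiction b∈B₂ a∉B₂
... | yes refl | no a≢b
  rewrite lookup∘update′ a≢b (B₁ [ a ]≔ outside) inside | lookup∘update a B₁ outside
        | lookup∘update a (B₂ [ b ]≔ outside) inside | []=⇒lookup a∈B₁ | ∉⇒lookup a∉B₂ = refl
... | no b≢a | yes refl
  rewrite lookup∘update b (B₁ [ a ]≔ outside) inside | lookup∘update′ b≢a (B₂ [ b ]≔ outside) inside
        | lookup∘update b B₂ outside | []=⇒lookup b∈B₂ | ∉⇒lookup b∉B₁ = refl
... | no i≢a | no i≢b
  rewrite lookup∘update′ i≢b (B₁ [ a ]≔ outside) inside | lookup∘update′ i≢a B₁ outside
        | lookup∘update′ i≢a (B₂ [ b ]≔ outside) inside | lookup∘update′ i≢b B₂ outside = refl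

module _ (M : Matroid n) {r : ℕ} (rank : HasRank M r) (paving : Paving M r) where

  nonbasis : Subset n → ℕ
  nonbasis B = if isBasis M B then 0 else 1

  nonbasis-yes : ∀ {B} → Basis M B → nonbasis B ≡ 0
  nonbasis-yes {B} β with isBasis M B
  ... | true = refl

  nonbasis-no : ∀ {B} → ¬ Basis M B → nonbasis B ≡ 1
  nonbasis-no {B} ¬β with isBasis M B
  ... | true  = contradiction _ ¬β
  ... | false = refl

  -- `k` bounds the number of non-bases. Each swap replaces a non-basis and an arbitrary r-set by
  -- two bases, so the number drops.
  paving-improve : ∀ k Bs → sumOver nonbasis Bs ≤ k → All (λ B → ∣ B ∣ ≡ r) Bs →
    (∀ H → Hyperplane M rank H → sumOver (λ B → ∣ H ∩ B ∣) Bs + length Bs ≤ r * length Bs) →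
    ∃ λ Bs′ → length Bs′ ≡ length Bs × All (Basis M) Bs′ × (∀ i → multiplicity Bs′ i ≡ multiplicity Bs i)
  paving-improve k Bs nb≤ sizes meets with All.all? (T? ∘ isBasis M) Bs
  ... | yes bs = Bs , refl , bs , λ _ → refl
  ... | no ¬bs with find (Allₚ.¬All⇒Any¬ (T? ∘ isBasis M) Bs ¬bs)
  ...   | B₁ , B₁∈ , ¬β₁ with ∈⇒↭∷ B₁∈
  ...     | ys , Bs↭ with All-resp-↭ Bs↭ sizes
  ...       | ∣B₁∣ ∷ ys-sizes with nonbasis⊆hyperplane M rank paving ∣B₁∣ ¬β₁
  ...         | H , h , B₁⊆H with All.all? (λ B → r ℕₚ.≤? suc ∣ H ∩ B ∣) ys
  ...           | yes big = contradiction (meets H h) (ℕₚ.<⇒≱ above)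
    where
    -- If every other set met `H` in at least r - 1 elements, then adding one per set would give at
    -- least (r + 1) + r (t - 1) > r t, where t is the length of the list.
    above : r * length Bs < sumOver (λ B → ∣ H ∩ B ∣) Bs + length Bs
    above = begin-strict
      r * length Bs                                   ≡⟨ cong (r *_) (↭-length Bs↭) ⟩
      r * suc (length ys)                             ≡⟨ ℕₚ.*-suc r (length ys) ⟩
      r + r * length ys                               <⟨ s≤s (ℕₚ.+-mono-≤ (subst (_≤ ∣ H ∩ B₁ ∣) ∣B₁∣ (p⊆q⇒∣p∣≤∣q∣ (λ x∈ → x∈p∩q⁺ (B₁⊆H x∈ , x∈)))) (length*≤sumOver (λ B → suc ∣ H ∩ B ∣) big)) ⟩
      sumOver (λ B → suc ∣ H ∩ B ∣) (B₁ ∷ ys)         ≡⟨ sumOver-↭ (λ B → suc ∣ H ∩ B ∣) Bs↭ ⟨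
      sumOver (λ B → suc ∣ H ∩ B ∣) Bs                ≡⟨ sumOver-suc (λ B → ∣ H ∩ B ∣) Bs ⟩
      sumOver (λ B → ∣ H ∩ B ∣) Bs + length Bs        ∎
      where open ℕₚ.≤-Reasoning
  ...           | no ¬big with find (Allₚ.¬All⇒Any¬ (λ B → r ℕₚ.≤? suc ∣ H ∩ B ∣) ys ¬big)
  ...             | B₂ , B₂∈ , r≰ with ∈⇒↭∷ B₂∈
  ...               | zs , ys↭ with All-resp-↭ ys↭ ys-sizes
  ...                 | ∣B₂∣ ∷ zs-sizes
    with exchange-out-of-hyperplane M rank paving H h ∣B₁∣ B₁⊆H ∣B₂∣ (ℕₚ.≰⇒> r≰)
  paving-improve zero Bs nb≤ sizes meets | no ¬bs | B₁ , B₁∈ , ¬β₁ | ys , Bs↭ | ∣B₁∣ ∷ ys-sizes | H , h , B₁⊆H | no ¬big | B₂ , B₂∈ , r≰ | zs , ys↭ | ∣B₂∣ ∷ zs-sizes | a , b , (a∈B₁ , a∉B₂) , (b∈B₂ , b∉B₁) , β₁′ , β₂′ =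
    contradiction (subst (_≤ 0) (trans (sumOver-↭ nonbasis Bs↭) (cong (_+ sumOver nonbasis ys) (nonbasis-no ¬β₁))) nb≤) (λ ())
  paving-improve (suc k) Bs nb≤ sizes meets | no ¬bs | B₁ , B₁∈ , ¬β₁ | ys , Bs↭ | ∣B₁∣ ∷ ys-sizes | H , h , B₁⊆H | no ¬big | B₂ , B₂∈ , r≰ | zs , ys↭ | ∣B₂∣ ∷ zs-sizes | a , b , (a∈B₁ , a∉B₂) , (b∈B₂ , b∉B₁) , β₁′ , β₂′ =
    let Bs″ , len , bs , mult = paving-improve k Bs′ nb′≤ (rank _ β₁′ ∷ rank _ β₂′ ∷ zs-sizes) meets′
    in Bs″ , trans len length≡ , bs , λ i → trans (mult i) (multiplicity≡ i)
    where
    B₁′ = (B₁ [ a ]≔ outside) [ b ]≔ inside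
    B₂′ = (B₂ [ b ]≔ outside) [ a ]≔ inside
    Bs′ = B₁′ ∷ B₂′ ∷ zs
    Bs↭′ : Bs ↭ B₁ ∷ B₂ ∷ zs
    Bs↭′ = ↭-trans Bs↭ (prep B₁ ys↭)
    length≡ : length Bs′ ≡ length Bs
    length≡ = sym (↭-length Bs↭′)
    multiplicity≡ : ∀ i → multiplicity Bs′ i ≡ multiplicity Bs i
    multiplicity≡ i = begin
      multiplicity Bs′ i                                      ≡⟨ ℕₚ.+-assoc (indicatorℕ B₁′ i) _ _ ⟨
      (indicatorℕ B₁′ i + indicatorℕ B₂′ i) + multiplicity zs i ≡⟨ cong (_+ multiplicity zs i) (indicator-exchange a∈B₁ a∉B₂ b∈B₂ b∉B₁ i) ⟩
      (indicatorℕ B₁ i + indicatorℕ B₂ i) + multiplicity zs i ≡⟨ ℕₚ.+-assoc (indicatorℕ B₁ i) _ _ ⟩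
      multiplicity (B₁ ∷ B₂ ∷ zs) i                           ≡⟨ sumOver-↭ (λ B → indicatorℕ B i) Bs↭′ ⟨
      multiplicity Bs i                                       ∎
      where open ≡-Reasoning
    -- The total intersection with `K` is the weight of `K` in the vector of multiplicities, which
    -- the swap does not change.
    meets′ : ∀ H → Hyperplane M rank H → sumOver (λ B → ∣ H ∩ B ∣) Bs′ + length Bs′ ≤ r * length Bs′
    meets′ K κ = subst₂ (λ s l → s + l ≤ r * l)
      (trans (sym (weight-multiplicity K Bs)) (trans (cong (weight K) (tabulate-cong (sym ∘ multiplicity≡))) (weight-multiplicity K Bs′)))
      (sym length≡) (meets K κ)
    nb′≤ : sumOver nonbasis Bs′ ≤ k
    nb′≤ = ℕₚ.≤-pred (begin
      suc (sumOver nonbasis Bs′)            ≡⟨ cong suc (cong₂ (λ p q → p + (q + sumOver nonbasis zs)) (nonbasis-yes β₁′) (nonbasis-yes β₂′)) ⟩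
      suc (sumOver nonbasis zs)             ≤⟨ s≤s (ℕₚ.m≤n+m _ (nonbasis B₂)) ⟩
      1 + (nonbasis B₂ + sumOver nonbasis zs) ≡⟨ cong (_+ (nonbasis B₂ + sumOver nonbasis zs)) (nonbasis-no ¬β₁) ⟨
      sumOver nonbasis (B₁ ∷ B₂ ∷ zs)       ≡⟨ sumOver-↭ nonbasis Bs↭′ ⟨
      sumOver nonbasis Bs                   ≤⟨ nb≤ ⟩
      suc k                                 ∎)
      where open ℕₚ.≤-Reasoning

  paving-decomposition : ∀ t (x : Vec ℕ n) → Bounded t x → Vec.sum x ≡ r * t →
    (∀ H → Hyperplane M rank H → weight H x + t ≤ r * t) →
    ∃ λ Bs → length Bs ≡ t × All (Basis M) Bs × (∀ i → multiplicity Bs i ≡ lookup x i)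
  paving-decomposition t x x≤ sum≡ hyper with uniform-decomposition t r x x≤ sum≡
  ... | Bs , refl , sizes , mult
    with paving-improve _ Bs ℕₚ.≤-refl sizes (λ H h → subst (λ s → s + length Bs ≤ r * length Bs)
      (trans (cong (weight H) (trans (sym (tabulate∘lookup x)) (tabulate-cong (sym ∘ mult)))) (weight-multiplicity H Bs)) (hyper H h))
  ... | Bs′ , len , bs , mult′ = Bs′ , len , bs , λ i → trans (mult′ i) (mult i)

-- Lattice points of the dilated base polytope

fromℤ : ℤ → ℚ
fromℤ z = z ℚ./ 1

toℚᵘ-fromℤ : ∀ z → toℚᵘ (fromℤ z) ℚᵘ.≃ mkℚᵘ z 0
toℚᵘ-fromℤ z = ℚₚ.toℚᵘ-fromℚᵘ (mkℚᵘ z 0)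

fromℤ-+ : ∀ a b → fromℤ a ℚ.+ fromℤ b ≡ fromℤ (a ℤ.+ b)
fromℤ-+ a b = ℚₚ.toℚᵘ-injective (begin
  toℚᵘ (fromℤ a ℚ.+ fromℤ b)           ≈⟨ ℚₚ.toℚᵘ-homo-+ (fromℤ a) (fromℤ b) ⟩
  toℚᵘ (fromℤ a) ℚᵘ.+ toℚᵘ (fromℤ b)   ≈⟨ ℚᵘₚ.+-cong (toℚᵘ-fromℤ a) (toℚᵘ-fromℤ b) ⟩
  mkℚᵘ a 0 ℚᵘ.+ mkℚᵘ b 0               ≈⟨ *≡* (cong (ℤ._* + 1) (cong₂ ℤ._+_ (ℤₚ.*-identityʳ a) (ℤₚ.*-identityʳ b))) ⟩
  mkℚᵘ (a ℤ.+ b) 0                     ≈⟨ toℚᵘ-fromℤ (a ℤ.+ b) ⟨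
  toℚᵘ (fromℤ (a ℤ.+ b))               ∎)
  where open ℚᵘₚ.≃-Reasoning

fromℤ-* : ∀ a b → fromℤ a ℚ.* fromℤ b ≡ fromℤ (a ℤ.* b)
fromℤ-* a b = ℚₚ.toℚᵘ-injective (begin
  toℚᵘ (fromℤ a ℚ.* fromℤ b)           ≈⟨ ℚₚ.toℚᵘ-homo-* (fromℤ a) (fromℤ b) ⟩
  toℚᵘ (fromℤ a) ℚᵘ.* toℚᵘ (fromℤ b)   ≈⟨ ℚᵘₚ.*-cong (toℚᵘ-fromℤ a) (toℚᵘ-fromℤ b) ⟩
  mkℚᵘ a 0 ℚᵘ.* mkℚᵘ b 0               ≈⟨ *≡* refl ⟩
  mkℚᵘ (a ℤ.* b) 0                     ≈⟨ toℚᵘ-fromℤ (a ℤ.* b) ⟨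
  toℚᵘ (fromℤ (a ℤ.* b))               ∎)
  where open ℚᵘₚ.≃-Reasoning

fromℤ-mono-≤ : ∀ {a b} → a ℤ.≤ b → fromℤ a ℚ.≤ fromℤ b
fromℤ-mono-≤ {a} {b} a≤b = ℚₚ.toℚᵘ-cancel-≤ (begin
  toℚᵘ (fromℤ a)  ≃⟨ toℚᵘ-fromℤ a ⟩
  mkℚᵘ a 0        ≤⟨ *≤* (ℤₚ.*-monoʳ-≤-nonNeg (+ 1) a≤b) ⟩
  mkℚᵘ b 0        ≃⟨ toℚᵘ-fromℤ b ⟨
  toℚᵘ (fromℤ b)  ∎)
  where open ℚᵘₚ.≤-Reasoning

fromℤ-cancel-≤ : ∀ {a b} → fromℤ a ℚ.≤ fromℤ b → a ℤ.≤ b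
fromℤ-cancel-≤ {a} {b} le = subst₂ ℤ._≤_ (ℤₚ.*-identityʳ a) (ℤₚ.*-identityʳ b) (ℚᵘₚ.drop-*≤* (begin
  mkℚᵘ a 0        ≃⟨ toℚᵘ-fromℤ a ⟨
  toℚᵘ (fromℤ a)  ≤⟨ ℚₚ.toℚᵘ-mono-≤ le ⟩
  toℚᵘ (fromℤ b)  ≃⟨ toℚᵘ-fromℤ b ⟩
  mkℚᵘ b 0        ∎))
  where open ℚᵘₚ.≤-Reasoning

weightℚ : Subset n → (Fin n → ℚ) → ℚ
weightℚ []            f = 0ℚ
weightℚ (inside ∷ A)  f = f zero ℚ.+ weightℚ A (f ∘ suc)
weightℚ (outside ∷ A) f = weightℚ A (f ∘ suc)

weightℤ : Subset n → Vec ℤ n → ℤ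
weightℤ []            []      = + 0
weightℤ (inside ∷ A)  (v ∷ x) = v ℤ.+ weightℤ A x
weightℤ (outside ∷ A) (v ∷ x) = weightℤ A x

weightℚ-cong : (A : Subset n) {f g : Fin n → ℚ} → f ≗ g → weightℚ A f ≡ weightℚ A g
weightℚ-cong []            eq = refl
weightℚ-cong (inside ∷ A)  eq = cong₂ ℚ._+_ (eq zero) (weightℚ-cong A (eq ∘ suc))
weightℚ-cong (outside ∷ A) eq = weightℚ-cong A (eq ∘ suc)

weightℚ-zero : (A : Subset n) → weightℚ A (λ _ → 0ℚ) ≡ 0ℚ
weightℚ-zero []            = refl
weightℚ-zero (inside ∷ A)  = trans (ℚₚ.+-identityˡ _) (weightℚ-zero A)
weightℚ-zero (outside ∷ A) = weightℚ-zero A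

weightℚ-+ : (A : Subset n) (f g : Fin n → ℚ) → weightℚ A (λ i → f i ℚ.+ g i) ≡ weightℚ A f ℚ.+ weightℚ A g
weightℚ-+ []            f g = refl
weightℚ-+ (outside ∷ A) f g = weightℚ-+ A (f ∘ suc) (g ∘ suc)
weightℚ-+ (inside ∷ A)  f g = trans (cong (ℚ._+_ (f zero ℚ.+ g zero)) (weightℚ-+ A (f ∘ suc) (g ∘ suc)))
  (ℚ-interchange (f zero) (g zero) _ _)

weightℚ-* : (A : Subset n) (c : ℚ) (f : Fin n → ℚ) → weightℚ A (λ i → c ℚ.* f i) ≡ c ℚ.* weightℚ A f
weightℚ-* []            c f = sym (ℚₚ.*-zeroʳ c)
weightℚ-* (outside ∷ A) c f = weightℚ-* A c (f ∘ suc)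
weightℚ-* (inside ∷ A)  c f = trans (cong (ℚ._+_ (c ℚ.* f zero)) (weightℚ-* A c (f ∘ suc)))
  (sym (ℚₚ.*-distribˡ-+ c (f zero) _))

weightℚ-fromℤ : (A : Subset n) (x : Vec ℤ n) → weightℚ A (λ i → fromℤ (lookup x i)) ≡ fromℤ (weightℤ A x)
weightℚ-fromℤ []            []      = refl
weightℚ-fromℤ (inside ∷ A)  (v ∷ x) = trans (cong (ℚ._+_ (fromℤ v)) (weightℚ-fromℤ A x)) (fromℤ-+ v _)
weightℚ-fromℤ (outside ∷ A) (v ∷ x) = weightℚ-fromℤ A x

weightℚ-indicator : (A B : Subset n) → weightℚ A (indicator B) ≡ fromℤ (+ ∣ A ∩ B ∣)
weightℚ-indicator []            []            = refl
weightℚ-indicator (inside ∷ A)  (inside ∷ B)  = trans (cong (ℚ._+_ 1ℚ) (weightℚ-indicator A B)) (fromℤ-+ (+ 1) (+ ∣ A ∩ B ∣))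
weightℚ-indicator (inside ∷ A)  (outside ∷ B) = trans (ℚₚ.+-identityˡ _) (weightℚ-indicator A B)
weightℚ-indicator (outside ∷ A) (_ ∷ B)       = weightℚ-indicator A B

toℤ : Vec ℕ n → Vec ℤ n
toℤ y = Vec.map +_ y

weightℤ-toℤ : (A : Subset n) (y : Vec ℕ n) → weightℤ A (toℤ y) ≡ + weight A y
weightℤ-toℤ []            []      = refl
weightℤ-toℤ (inside ∷ A)  (v ∷ y) = cong (ℤ._+_ (+ v)) (weightℤ-toℤ A y)
weightℤ-toℤ (outside ∷ A) (v ∷ y) = weightℤ-toℤ A y

weightℤ-⊥ : (x : Vec ℤ n) → weightℤ ⊥ x ≡ + 0
weightℤ-⊥ []      = refl
weightℤ-⊥ (v ∷ x) = weightℤ-⊥ x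

weightℤ-⁅⁆ : (i : Fin n) (x : Vec ℤ n) → weightℤ ⁅ i ⁆ x ≡ lookup x i
weightℤ-⁅⁆ zero    (v ∷ x) = trans (cong (ℤ._+_ v) (weightℤ-⊥ x)) (ℤₚ.+-identityʳ v)
weightℤ-⁅⁆ (suc i) (v ∷ x) = weightℤ-⁅⁆ i x

weight-⊤ : (y : Vec ℕ n) → weight ⊤ y ≡ Vec.sum y
weight-⊤ []      = refl
weight-⊤ (v ∷ y) = cong₂ _+_ refl (weight-⊤ y)

combine : (Subset n → ℚ) → List (Subset n × ℚ) → ℚ
combine f cs = sumℚ (map (λ p → proj₂ p ℚ.* f (proj₁ p)) cs)

combine-const : (c : ℚ) (cs : List (Subset n × ℚ)) → combine (λ _ → c) cs ≡ sumℚ (map proj₂ cs) ℚ.* c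
combine-const c []             = sym (ℚₚ.*-zeroˡ c)
combine-const c ((B , q) ∷ cs) = trans (cong (ℚ._+_ (q ℚ.* c)) (combine-const c cs)) (sym (ℚₚ.*-distribʳ-+ c q _))

weightℚ-combine : (A : Subset n) (cs : List (Subset n × ℚ)) →
  weightℚ A (λ i → combine (λ B → indicator B i) cs) ≡ combine (λ B → fromℤ (+ ∣ A ∩ B ∣)) cs
weightℚ-combine A []             = weightℚ-zero A
weightℚ-combine A ((B , q) ∷ cs) = trans (weightℚ-+ A (λ i → q ℚ.* indicator B i) (λ i → combine (λ B → indicator B i) cs))
  (cong₂ ℚ._+_ (trans (weightℚ-* A q (indicator B)) (cong (q ℚ.*_) (weightℚ-indicator A B))) (weightℚ-combine A cs))

combine-mono : (isB : Subset n → Bool) {f g : Subset n → ℚ} → (∀ B → T (isB B) → f B ℚ.≤ g B) →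
  {cs : List (Subset n × ℚ)} → All (λ p → T (isB (proj₁ p)) × 0ℚ ℚ.≤ proj₂ p) cs → combine f cs ℚ.≤ combine g cs
combine-mono isB f≤g []                              = ℚₚ.≤-refl
combine-mono isB f≤g {(B , q) ∷ cs} ((β , q≥0) ∷ all) =
  ℚₚ.+-mono-≤ (ℚₚ.*-monoˡ-≤-nonNeg q {{ℚ.nonNegative q≥0}} (f≤g B β)) (combine-mono isB f≤g all)

module _ (isB : Subset n → Bool) (t : ℕ) (x : Vec ℤ n) where

  private
    combine-fromℤ : (p : InDilatedBasePolytope isB t x) → ∀ k → combine (λ _ → fromℤ (+ k)) (proj₁ p) ≡ fromℤ (+ (t * k))
    combine-fromℤ (cs , _ , total , _) k = begin
      combine (λ _ → fromℤ (+ k)) cs              ≡⟨ combine-const (fromℤ (+ k)) cs ⟩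
      sumℚ (map proj₂ cs) ℚ.* fromℤ (+ k)         ≡⟨ cong (ℚ._* fromℤ (+ k)) total ⟩
      fromℤ (+ t) ℚ.* fromℤ (+ k)                 ≡⟨ fromℤ-* (+ t) (+ k) ⟩
      fromℤ (+ t ℤ.* + k)                         ≡⟨ cong fromℤ (ℤₚ.pos-* t k) ⟨
      fromℤ (+ (t * k))                           ∎
      where open ≡-Reasoning

    weight-combine : (p : InDilatedBasePolytope isB t x) → ∀ A → combine (λ B → fromℤ (+ ∣ A ∩ B ∣)) (proj₁ p) ≡ fromℤ (weightℤ A x)
    weight-combine (cs , _ , _ , coord) A = begin
      combine (λ B → fromℤ (+ ∣ A ∩ B ∣)) cs              ≡⟨ weightℚ-combine A cs ⟨
      weightℚ A (λ i → combine (λ B → indicator B i) cs)  ≡⟨ weightℚ-cong A coord ⟩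
      weightℚ A (λ i → fromℤ (lookup x i))                ≡⟨ weightℚ-fromℤ A x ⟩
      fromℤ (weightℤ A x)                                 ∎
      where open ≡-Reasoning

  -- A linear functional on a polytope is bounded by its values at the vertices: x(A) is the sum of
  -- the |A ∩ B| with nonnegative coefficients of total t.
  polytope-weight-≤ : InDilatedBasePolytope isB t x → ∀ A k → (∀ B → T (isB B) → ∣ A ∩ B ∣ ≤ k) → weightℤ A x ℤ.≤ + (t * k)
  polytope-weight-≤ p@(_ , all , _) A k le = fromℤ-cancel-≤ (subst₂ ℚ._≤_ (weight-combine p A) (combine-fromℤ p k)
    (combine-mono isB (λ B β → fromℤ-mono-≤ (ℤ.+≤+ (le B β))) all))

  polytope-weight-≥ : InDilatedBasePolytope isB t x → ∀ A k → (∀ B → T (isB B) → k ≤ ∣ A ∩ B ∣) → + (t * k) ℤ.≤ weightℤ A x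
  polytope-weight-≥ p@(_ , all , _) A k le = fromℤ-cancel-≤ (subst₂ ℚ._≤_ (combine-fromℤ p k) (weight-combine p A)
    (combine-mono isB (λ B β → fromℤ-mono-≤ (ℤ.+≤+ (le B β))) all))

  -- The lower bound 0 for singletons; it lets the rest of the argument work with natural
  -- coordinates.
  polytope-nonNegative : InDilatedBasePolytope isB t x → ∃ λ y → x ≡ toℤ y
  polytope-nonNegative p = Vec.map ℤ.∣_∣ x , lift x nonNeg
    where
    nonNeg : ∀ i → + 0 ℤ.≤ lookup x i
    nonNeg i = subst₂ ℤ._≤_ (cong +_ (ℕₚ.*-zeroʳ t)) (weightℤ-⁅⁆ i x) (polytope-weight-≥ p ⁅ i ⁆ 0 (λ _ _ → z≤n))
    lift : ∀ {m} (z : Vec ℤ m) → (∀ i → + 0 ℤ.≤ lookup z i) → z ≡ toℤ (Vec.map ℤ.∣_∣ z)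
    lift []      _   = refl
    lift (v ∷ z) pos = cong₂ _∷_ (sym (ℤₚ.0≤i⇒+∣i∣≡i (pos zero))) (lift z (pos ∘ suc))

module _ (isB : Subset n → Bool) (t : ℕ) (y : Vec ℕ n) where

  polytope-weightℕ-≤ : InDilatedBasePolytope isB t (toℤ y) → ∀ A k → (∀ B → T (isB B) → ∣ A ∩ B ∣ ≤ k) → weight A y ≤ t * k
  polytope-weightℕ-≤ p A k le = ℤₚ.drop‿+≤+ (subst (ℤ._≤ + (t * k)) (weightℤ-toℤ A y) (polytope-weight-≤ isB t (toℤ y) p A k le))

  polytope-bounded : InDilatedBasePolytope isB t (toℤ y) → Bounded t y
  polytope-bounded p = lookup⁻ λ i → ℤₚ.drop‿+≤+ (subst₂ ℤ._≤_ (trans (weightℤ-⁅⁆ i (toℤ y)) (lookup-map i +_ y)) (cong +_ (ℕₚ.*-identityʳ t))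
    (polytope-weight-≤ isB t (toℤ y) p ⁅ i ⁆ 1 (λ B _ → ℕₚ.≤-trans (∣p∩q∣≤∣p∣ ⁅ i ⁆ B) (ℕₚ.≤-reflexive (∣⁅x⁆∣≡1 i)))))

  polytope-sum : ∀ {r} → (∀ B → T (isB B) → ∣ B ∣ ≡ r) → InDilatedBasePolytope isB t (toℤ y) → Vec.sum y ≡ r * t
  polytope-sum {r} rank p = trans (sym (weight-⊤ y)) (trans (ℕₚ.≤-antisym
    (polytope-weightℕ-≤ p ⊤ r (λ B β → ℕₚ.≤-reflexive (∣⊤∩∣ B β)))
    (ℤₚ.drop‿+≤+ (subst (+ (t * r) ℤ.≤_) (weightℤ-toℤ ⊤ y) (polytope-weight-≥ isB t (toℤ y) p ⊤ r (λ B β → ℕₚ.≤-reflexive (sym (∣⊤∩∣ B β)))))))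
    (ℕₚ.*-comm t r))
    where
    ∣⊤∩∣ : ∀ B → T (isB B) → ∣ ⊤ ∩ B ∣ ≡ r
    ∣⊤∩∣ B β = trans (cong ∣_∣ (∩-identityˡ B)) (rank B β)

polytope-hyperplane : (M : Matroid n) {r : ℕ} (rank : HasRank M r) (t : ℕ) {y : Vec ℕ n} →
  InDilatedBasePolytope (isBasis M) t (toℤ y) → ∀ H → Hyperplane M rank H → weight H y + t ≤ r * t
polytope-hyperplane M {r} rank t {y} y∈P H h = begin
  weight H y + t        ≤⟨ ℕₚ.+-monoˡ-≤ t (polytope-weightℕ-≤ (isBasis M) t y y∈P H (rk M H) (λ B → ≤-rk M H)) ⟩
  t * rk M H + t        ≡⟨ ℕₚ.+-comm (t * rk M H) t ⟩
  t + t * rk M H        ≡⟨ ℕₚ.*-suc t (rk M H) ⟨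
  t * suc (rk M H)      ≡⟨ cong (t *_) (hyperplane⇒rk M rank H h) ⟩
  t * r                 ≡⟨ ℕₚ.*-comm t r ⟩
  r * t                 ∎
  where open ℕₚ.≤-Reasoning

indicator-fromℤ : (B : Subset n) (i : Fin n) → indicator B i ≡ fromℤ (+ indicatorℕ B i)
indicator-fromℤ B i with lookup B i
... | true  = refl
... | false = refl

-- The list of bases is itself a certificate, each entry with coefficient 1. Repeated bases are
-- allowed there, so equal ones need not be merged.
decomposition⇒polytope : {isB : Subset n → Bool} (Bs : List (Subset n)) {t : ℕ} (y : Vec ℕ n) →
  length Bs ≡ t → All (T ∘ isB) Bs →
  (∀ i → multiplicity Bs i ≡ lookup y i) → InDilatedBasePolytope isB t (toℤ y)
decomposition⇒polytope {n} {isB} Bs y refl bs mult = units Bs , nonNeg bs , total Bs ,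
  λ i → trans (coord Bs i) (cong fromℤ (trans (cong +_ (mult i)) (sym (lookup-map i +_ y))))
  where
  units : List (Subset n) → List (Subset n × ℚ)
  units = map (_, 1ℚ)
  nonNeg : ∀ {Bs} → All (T ∘ isB) Bs → All (λ p → T (isB (proj₁ p)) × 0ℚ ℚ.≤ proj₂ p) (units Bs)
  nonNeg []       = []
  nonNeg (β ∷ bs) = (β , ℚₚ.nonNegative⁻¹ 1ℚ) ∷ nonNeg bs
  total : ∀ Bs → sumℚ (map proj₂ (units Bs)) ≡ fromℤ (+ length Bs)
  total []       = refl
  total (B ∷ Bs) = trans (cong (ℚ._+_ 1ℚ) (total Bs)) (fromℤ-+ (+ 1) (+ length Bs))
  coord : ∀ Bs i → combine (λ B → indicator B i) (units Bs) ≡ fromℤ (+ multiplicity Bs i)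
  coord []       i = refl
  coord (B ∷ Bs) i = trans (cong₂ ℚ._+_ (trans (ℚₚ.*-identityˡ _) (indicator-fromℤ B i)) (coord Bs i)) (fromℤ-+ (+ indicatorℕ B i) (+ multiplicity Bs i))

-- Finite sums and generating functions

open ≡-Reasoning

∑ : {A : Set} → List A → (A → ℤ) → ℤ
∑ xs f = sumℤ (map f xs)

∑-cong-∈ : {A : Set} (xs : List A) {f g : A → ℤ} → (∀ x → x ∈ₗ xs → f x ≡ g x) → ∑ xs f ≡ ∑ xs g
∑-cong-∈ []       eq = refl
∑-cong-∈ (x ∷ xs) eq = cong₂ ℤ._+_ (eq x (here refl)) (∑-cong-∈ xs (λ y y∈ → eq y (there y∈)))

∑-cong : {A : Set} (xs : List A) {f g : A → ℤ} → (∀ x → f x ≡ g x) → ∑ xs f ≡ ∑ xs g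
∑-cong xs eq = ∑-cong-∈ xs (λ x _ → eq x)

∑-zero : {A : Set} (xs : List A) → ∑ xs (λ _ → + 0) ≡ + 0
∑-zero []       = refl
∑-zero (x ∷ xs) = trans (ℤₚ.+-identityˡ _) (∑-zero xs)

∑-+ : {A : Set} (xs : List A) (f g : A → ℤ) → ∑ xs (λ x → f x ℤ.+ g x) ≡ ∑ xs f ℤ.+ ∑ xs g
∑-+ []       f g = refl
∑-+ (x ∷ xs) f g rewrite ∑-+ xs f g = ℤ-interchange (f x) (g x) (∑ xs f) (∑ xs g)

difference-interchange : ∀ a b c d → (a ℤ.- b) ℤ.+ (c ℤ.- d) ≡ (a ℤ.+ c) ℤ.- (b ℤ.+ d)
difference-interchange = solve-∀

∑-sub : {A : Set} (xs : List A) (f g : A → ℤ) → ∑ xs (λ x → f x ℤ.- g x) ≡ ∑ xs f ℤ.- ∑ xs g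
∑-sub []       f g = refl
∑-sub (x ∷ xs) f g rewrite ∑-sub xs f g = difference-interchange (f x) (g x) (∑ xs f) (∑ xs g)

∑-*ˡ : {A : Set} (xs : List A) (c : ℤ) (f : A → ℤ) → ∑ xs (λ x → c ℤ.* f x) ≡ c ℤ.* ∑ xs f
∑-*ˡ []       c f = sym (ℤₚ.*-zeroʳ c)
∑-*ˡ (x ∷ xs) c f = trans (cong (ℤ._+_ (c ℤ.* f x)) (∑-*ˡ xs c f)) (sym (ℤₚ.*-distribˡ-+ c (f x) (∑ xs f)))

∑-*ʳ : {A : Set} (xs : List A) (c : ℤ) (f : A → ℤ) → ∑ xs (λ x → f x ℤ.* c) ≡ ∑ xs f ℤ.* c
∑-*ʳ xs c f = trans (∑-cong xs (λ x → ℤₚ.*-comm (f x) c)) (trans (∑-*ˡ xs c f) (ℤₚ.*-comm c (∑ xs f)))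

∑-swap : {A B : Set} (xs : List A) (ys : List B) (f : A → B → ℤ) →
         ∑ xs (λ x → ∑ ys (f x)) ≡ ∑ ys (λ y → ∑ xs (λ x → f x y))
∑-swap []       ys f = sym (∑-zero ys)
∑-swap (x ∷ xs) ys f = trans (cong (ℤ._+_ (∑ ys (f x))) (∑-swap xs ys f)) (sym (∑-+ ys (f x) (λ y → ∑ xs (λ z → f z y))))

∑-++ : {A : Set} (xs ys : List A) (f : A → ℤ) → ∑ (xs ++ ys) f ≡ ∑ xs f ℤ.+ ∑ ys f
∑-++ []       ys f = sym (ℤₚ.+-identityˡ _)
∑-++ (x ∷ xs) ys f = trans (cong (ℤ._+_ (f x)) (∑-++ xs ys f)) (sym (ℤₚ.+-assoc (f x) _ _))

∑-map : {A B : Set} (g : A → B) (xs : List A) (f : B → ℤ) → ∑ (map g xs) f ≡ ∑ xs (f ∘ g)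
∑-map g xs f = cong sumℤ (sym (Listₚ.map-∘ xs))

∑-upTo-head : ∀ n (f : ℕ → ℤ) → ∑ (upTo (suc n)) f ≡ f 0 ℤ.+ ∑ (upTo n) (f ∘ suc)
∑-upTo-head n f = cong (λ l → f 0 ℤ.+ sumℤ l)
  (trans (Listₚ.map-applyUpTo suc f n) (sym (Listₚ.map-upTo (f ∘ suc) n)))

∑-upTo-last : ∀ n (f : ℕ → ℤ) → ∑ (upTo (suc n)) f ≡ ∑ (upTo n) f ℤ.+ f n
∑-upTo-last n f = begin
  ∑ (upTo (suc n)) f         ≡⟨ cong (λ l → ∑ l f) (Listₚ.upTo-∷ʳ n) ⟨
  ∑ (upTo n ++ (n ∷ [])) f   ≡⟨ ∑-++ (upTo n) (n ∷ []) f ⟩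
  ∑ (upTo n) f ℤ.+ (f n ℤ.+ + 0) ≡⟨ cong (ℤ._+_ (∑ (upTo n) f)) (ℤₚ.+-identityʳ (f n)) ⟩
  ∑ (upTo n) f ℤ.+ f n       ∎

∑-upTo-reverse : ∀ n (f : ℕ → ℤ) → ∑ (upTo (suc n)) (λ i → f (n ∸ i)) ≡ ∑ (upTo (suc n)) f
∑-upTo-reverse zero    f = refl
∑-upTo-reverse (suc n) f = begin
  ∑ (upTo (suc (suc n))) (λ i → f (suc n ∸ i))  ≡⟨ ∑-upTo-head (suc n) (λ i → f (suc n ∸ i)) ⟩
  f (suc n) ℤ.+ ∑ (upTo (suc n)) (λ i → f (n ∸ i)) ≡⟨ cong (ℤ._+_ (f (suc n))) (∑-upTo-reverse n f) ⟩
  f (suc n) ℤ.+ ∑ (upTo (suc n)) f              ≡⟨ ℤₚ.+-comm (f (suc n)) _ ⟩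
  ∑ (upTo (suc n)) f ℤ.+ f (suc n)              ≡⟨ ∑-upTo-last (suc n) f ⟨
  ∑ (upTo (suc (suc n))) f                      ∎

∑-upTo-extend : ∀ a b (f : ℕ → ℤ) → (∀ i → a ≤ i → f i ≡ + 0) → ∑ (upTo (b + a)) f ≡ ∑ (upTo a) f
∑-upTo-extend a zero    f f≡0 = refl
∑-upTo-extend a (suc b) f f≡0 = begin
  ∑ (upTo (suc b + a)) f         ≡⟨ ∑-upTo-last (b + a) f ⟩
  ∑ (upTo (b + a)) f ℤ.+ f (b + a) ≡⟨ cong₂ ℤ._+_ (∑-upTo-extend a b f f≡0) (f≡0 (b + a) (ℕₚ.m≤n+m a b)) ⟩
  ∑ (upTo a) f ℤ.+ + 0           ≡⟨ ℤₚ.+-identityʳ _ ⟩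
  ∑ (upTo a) f                   ∎

-- A sequence stands for its generating function: shift k is multiplication by z^k, acc by
-- 1/(1 - z), diff t by 1 - z^(t+1) and box t by 1 + z + ... + z^t.
Seq : Set
Seq = ℕ → ℤ

δ : Seq
δ zero    = + 1
δ (suc _) = + 0

shift : ℕ → Seq → Seq
shift zero    f N       = f N
shift (suc k) f zero    = + 0
shift (suc k) f (suc N) = shift k f N

acc : Seq → Seq
acc f zero    = f zero
acc f (suc N) = f (suc N) ℤ.+ acc f N

diff : ℕ → Seq → Seq
diff t f N = f N ℤ.- shift (suc t) f N

box : ℕ → Seq → Seq
box t f N = ∑ (upTo (suc t)) (λ v → shift v f N)

shift-cong : ∀ k {f g : Seq} → f ≗ g → shift k f ≗ shift k g
shift-cong zero    eq N       = eq N
shift-cong (suc k) eq zero    = refl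
shift-cong (suc k) eq (suc N) = shift-cong k eq N

shift-sub : ∀ k (f g : Seq) → shift k (λ N → f N ℤ.- g N) ≗ λ N → shift k f N ℤ.- shift k g N
shift-sub zero    f g N       = refl
shift-sub (suc k) f g zero    = refl
shift-sub (suc k) f g (suc N) = shift-sub k f g N

shift-shift : ∀ j k f → shift j (shift k f) ≗ shift (j + k) f
shift-shift zero    k f N       = refl
shift-shift (suc j) k f zero    = refl
shift-shift (suc j) k f (suc N) = shift-shift j k f N

shift-≤ : ∀ k f N → k ≤ N → shift k f N ≡ f (N ∸ k)
shift-≤ zero    f N       _         = refl
shift-≤ (suc k) f (suc N) (s≤s k≤N) = shift-≤ k f N k≤N

shift-> : ∀ k f N → N < k → shift k f N ≡ + 0
shift-> (suc k) f zero    _         = refl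
shift-> (suc k) f (suc N) (s≤s N<k) = shift-> k f N N<k

acc-sub : ∀ (f g : Seq) → acc (λ N → f N ℤ.- g N) ≗ λ N → acc f N ℤ.- acc g N
acc-sub f g zero    = refl
acc-sub f g (suc N) rewrite acc-sub f g N = difference-interchange (f (suc N)) (g (suc N)) (acc f N) (acc g N)

acc-shift-suc : ∀ k f N → acc (shift (suc k) f) (suc N) ≡ acc (shift k f) N
acc-shift-suc k f zero    = ℤₚ.+-identityʳ _
acc-shift-suc k f (suc N) = cong (ℤ._+_ (shift k f (suc N))) (acc-shift-suc k f N)

acc-shift : ∀ k f → acc (shift k f) ≗ shift k (acc f)
acc-shift zero    f N       = refl
acc-shift (suc k) f zero    = refl
acc-shift (suc k) f (suc N) = trans (acc-shift-suc k f N) (acc-shift k f N)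

diff-cong : ∀ t {f g : Seq} → f ≗ g → diff t f ≗ diff t g
diff-cong t eq N = cong₂ ℤ._-_ (eq N) (shift-cong (suc t) eq N)

acc-diff : ∀ t f → acc (diff t f) ≗ diff t (acc f)
acc-diff t f N = trans (acc-sub f (shift (suc t) f) N) (cong (ℤ._-_ (acc f N)) (acc-shift (suc t) f N))

shift-diff : ∀ t f → shift (suc t) (diff t f) ≗ diff t (shift (suc t) f)
shift-diff t f = shift-sub (suc t) f (shift (suc t) f)

box-cong : ∀ t {f g : Seq} → f ≗ g → box t f ≗ box t g
box-cong t eq N = ∑-cong (upTo (suc t)) (λ v → shift-cong v eq N)

acc-unfold : ∀ f N → f N ≡ acc f N ℤ.- shift 1 (acc f) N
acc-unfold f zero    = sym (ℤₚ.+-identityʳ _)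
acc-unfold f (suc N) = cancel (f (suc N)) (acc f N)
  where
  cancel : ∀ a b → a ≡ (a ℤ.+ b) ℤ.- b
  cancel = solve-∀

shift-unfold : ∀ k f N → shift k f N ≡ shift k (acc f) N ℤ.- shift (suc k) (acc f) N
shift-unfold zero    f N       = acc-unfold f N
shift-unfold (suc k) f zero    = refl
shift-unfold (suc k) f (suc N) = shift-unfold k f N

-- The geometric sum 1 + z + ... + z^t = (1 - z^(t+1)) / (1 - z): each z^v is (z^v - z^(v+1)) / (1 -
-- z), and these telescope.
box-acc : ∀ t f → box t f ≗ diff t (acc f)
box-acc zero    f N = trans (ℤₚ.+-identityʳ _) (acc-unfold f N)
box-acc (suc t) f N = begin
  box (suc t) f N
    ≡⟨ ∑-upTo-last (suc t) (λ v → shift v f N) ⟩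
  box t f N ℤ.+ shift (suc t) f N
    ≡⟨ cong₂ ℤ._+_ (box-acc t f N) (shift-unfold (suc t) f N) ⟩
  (acc f N ℤ.- shift (suc t) (acc f) N) ℤ.+ (shift (suc t) (acc f) N ℤ.- shift (suc (suc t)) (acc f) N)
    ≡⟨ telescope (acc f N) (shift (suc t) (acc f) N) (shift (suc (suc t)) (acc f) N) ⟩
  diff (suc t) (acc f) N ∎
  where
  telescope : ∀ a b c → (a ℤ.- b) ℤ.+ (b ℤ.- c) ≡ a ℤ.- c
  telescope = solve-∀

fold-diff-acc : ∀ t k f → acc (fold f (diff t) k) ≗ fold (acc f) (diff t) k
fold-diff-acc t zero    f N = refl
fold-diff-acc t (suc k) f N =
  trans (acc-diff t (fold f (diff t) k) N) (diff-cong t (fold-diff-acc t k f) N)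

fold-diff-shift : ∀ t k f → fold (shift (suc t) f) (diff t) k ≗ shift (suc t) (fold f (diff t) k)
fold-diff-shift t zero    f N = refl
fold-diff-shift t (suc k) f N =
  trans (diff-cong t (fold-diff-shift t k f) N) (sym (shift-diff t (fold f (diff t) k) N))

-- Multiplying by a power of 1 - z^(t+1) alters no coefficient below z^(t+1).
fold-diff-≤ : ∀ t k f N → N ≤ t → fold f (diff t) k N ≡ f N
fold-diff-≤ t zero    f N N≤t = refl
fold-diff-≤ t (suc k) f N N≤t = begin
  fold f (diff t) k N ℤ.- shift (suc t) (fold f (diff t) k) N
    ≡⟨ cong₂ ℤ._-_ (fold-diff-≤ t k f N N≤t) (shift-> (suc t) _ N (s≤s N≤t)) ⟩
  f N ℤ.- + 0
    ≡⟨ ℤₚ.+-identityʳ _ ⟩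
  f N ∎

-- The coefficients of (1 + z + ... + z^t)^k: how many points of [0,t]^k have a given total.
boxCount : ℕ → ℕ → Seq
boxCount t k = fold δ (box t) k

-- The operators commute, so all factors 1 - z^(t+1) can be collected outside (1 - z)^(-k).
boxCount-diff-acc : ∀ t k → boxCount t k ≗ fold (fold δ acc k) (diff t) k
boxCount-diff-acc t zero    N = refl
boxCount-diff-acc t (suc k) N = begin
  box t (boxCount t k) N                        ≡⟨ box-cong t (boxCount-diff-acc t k) N ⟩
  box t (fold (fold δ acc k) (diff t) k) N      ≡⟨ box-acc t _ N ⟩
  diff t (acc (fold (fold δ acc k) (diff t) k)) N ≡⟨ diff-cong t (fold-diff-acc t k _) N ⟩
  diff t (fold (acc (fold δ acc k)) (diff t) k) N ∎

nC0≡1 : ∀ n → n C 0 ≡ 1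
nC0≡1 n = trans (nCk≡nC[n∸k] {0} {n} z≤n) (nCn≡1 n)

-- The coefficients of (1 - z)^(-(k+1)). The recursion of `acc` is Pascal's rule.
fold-acc-δ : ∀ k N → fold δ acc (suc k) N ≡ + ((N + k) C k)
fold-acc-δ zero    zero    = refl
fold-acc-δ zero    (suc N) = begin
  + 0 ℤ.+ acc δ N          ≡⟨ ℤₚ.+-identityˡ _ ⟩
  acc δ N                  ≡⟨ fold-acc-δ zero N ⟩
  + ((N + 0) C 0)          ≡⟨ cong +_ (trans (nC0≡1 (N + 0)) (sym (nC0≡1 (suc N + 0)))) ⟩
  + ((suc N + 0) C 0)      ∎
fold-acc-δ (suc k) zero    = trans (fold-acc-δ k zero) (cong +_ (trans (nCn≡1 k) (sym (nCn≡1 (suc k)))))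
fold-acc-δ (suc k) (suc N) = begin
  fold δ acc (suc k) (suc N) ℤ.+ fold δ acc (suc (suc k)) N
    ≡⟨ cong₂ ℤ._+_ (fold-acc-δ k (suc N)) (fold-acc-δ (suc k) N) ⟩
  + ((suc N + k) C k + (N + suc k) C suc k)
    ≡⟨ cong (λ z → + ((suc N + k) C k + z C suc k)) (ℕₚ.+-suc N k) ⟩
  + ((suc N + k) C k + (suc N + k) C suc k)
    ≡⟨ cong +_ (nCk+nC[k+1]≡[n+1]C[k+1] (suc N + k) k) ⟩
  + (suc (suc N + k) C suc k)
    ≡⟨ cong (λ z → + (suc z C suc k)) (ℕₚ.+-suc N k) ⟨
  + ((suc N + suc k) C suc k) ∎

signedC : ℕ → ℕ → ℤ
signedC s i = (-[1+ 0 ] ℤ.^ i) ℤ.* + (s C i)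

signedC-0 : ∀ s → signedC s 0 ≡ + 1
signedC-0 s rewrite nC0≡1 s = refl

signedC-suc : ∀ s i → signedC (suc s) (suc i) ≡ signedC s (suc i) ℤ.- signedC s i
signedC-suc s i rewrite sym (nCk+nC[k+1]≡[n+1]C[k+1] s i) | ℤₚ.pos-+ (s C i) (s C suc i) =
  distribute (-[1+ 0 ] ℤ.^ i) (+ (s C i)) (+ (s C suc i))
  where
  distribute : ∀ p a b → (-[1+ 0 ] ℤ.* p) ℤ.* (a ℤ.+ b) ≡ (-[1+ 0 ] ℤ.* p) ℤ.* b ℤ.- p ℤ.* a
  distribute = solve-∀

-- The binomial theorem for (1 - z^(t+1))^s. The slack `d` lets the sum run past s, where the
-- coefficients vanish. The induction needs it: Pascal's rule yields two sums for s whose ranges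
-- differ by one.
fold-diff-expand : ∀ t s d f N →
  ∑ (upTo (suc (d + s))) (λ i → signedC s i ℤ.* shift (i * suc t) f N) ≡ fold f (diff t) s N
fold-diff-expand t zero    d f N = begin
  ∑ (upTo (suc (d + 0))) term  ≡⟨ cong (λ z → ∑ (upTo z) term) (ℕₚ.+-suc d 0) ⟨
  ∑ (upTo (d + 1)) term        ≡⟨ ∑-upTo-extend 1 d term vanish ⟩
  term 0 ℤ.+ + 0               ≡⟨ ℤₚ.+-identityʳ _ ⟩
  + 1 ℤ.* f N                  ≡⟨ ℤₚ.*-identityˡ _ ⟩
  f N                          ∎
  where
  term = λ i → signedC 0 i ℤ.* shift (i * suc t) f N
  vanish : ∀ i → 1 ≤ i → term i ≡ + 0
  vanish (suc i) _ rewrite k>n⇒nCk≡0 {0} {suc i} (s≤s z≤n) | ℤₚ.*-zeroʳ (-[1+ 0 ] ℤ.^ suc i) = refl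
fold-diff-expand t (suc s) d f N = begin
  ∑ (upTo (suc (d + suc s))) (λ i → signedC (suc s) i ℤ.* g i)
    ≡⟨ cong (λ z → ∑ (upTo (suc z)) (λ i → signedC (suc s) i ℤ.* g i)) (ℕₚ.+-suc d s) ⟩
  ∑ (upTo (suc (suc (d + s)))) (λ i → signedC (suc s) i ℤ.* g i)
    ≡⟨ ∑-upTo-head (suc (d + s)) (λ i → signedC (suc s) i ℤ.* g i) ⟩
  signedC (suc s) 0 ℤ.* g 0 ℤ.+ ∑ I (λ i → signedC (suc s) (suc i) ℤ.* g (suc i))
    ≡⟨ cong₂ ℤ._+_ (cong (ℤ._* g 0) (trans (signedC-0 (suc s)) (sym (signedC-0 s)))) (∑-cong I pascal) ⟩
  signedC s 0 ℤ.* g 0 ℤ.+ ∑ I (λ i → signedC s (suc i) ℤ.* g (suc i) ℤ.- signedC s i ℤ.* g′ i)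
    ≡⟨ cong (ℤ._+_ (signedC s 0 ℤ.* g 0)) (∑-sub I (λ i → signedC s (suc i) ℤ.* g (suc i)) (λ i → signedC s i ℤ.* g′ i)) ⟩
  signedC s 0 ℤ.* g 0 ℤ.+ (∑ I (λ i → signedC s (suc i) ℤ.* g (suc i)) ℤ.- ∑ I (λ i → signedC s i ℤ.* g′ i))
    ≡⟨ ℤₚ.+-assoc (signedC s 0 ℤ.* g 0) (∑ I (λ i → signedC s (suc i) ℤ.* g (suc i))) _ ⟨
  (signedC s 0 ℤ.* g 0 ℤ.+ ∑ I (λ i → signedC s (suc i) ℤ.* g (suc i))) ℤ.- ∑ I (λ i → signedC s i ℤ.* g′ i)
    ≡⟨ cong (ℤ._- ∑ I (λ i → signedC s i ℤ.* g′ i)) (∑-upTo-head (suc (d + s)) (λ i → signedC s i ℤ.* g i)) ⟨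
  ∑ (upTo (suc (suc d + s))) (λ i → signedC s i ℤ.* g i) ℤ.- ∑ I (λ i → signedC s i ℤ.* g′ i)
    ≡⟨ cong₂ ℤ._-_ (fold-diff-expand t s (suc d) f N) (fold-diff-expand t s d (shift (suc t) f) N) ⟩
  fold f (diff t) s N ℤ.- fold (shift (suc t) f) (diff t) s N
    ≡⟨ cong (ℤ._-_ (fold f (diff t) s N)) (fold-diff-shift t s f N) ⟩
  fold f (diff t) (suc s) N ∎
  where
  I = upTo (suc (d + s))
  g = λ i → shift (i * suc t) f N
  g′ = λ i → shift (i * suc t) (shift (suc t) f) N
  g-suc : ∀ i → g (suc i) ≡ g′ i
  g-suc i = trans (cong (λ z → shift z f N) (ℕₚ.+-comm (suc t) (i * suc t))) (sym (shift-shift (i * suc t) (suc t) f N))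
  pascal : ∀ i → signedC (suc s) (suc i) ℤ.* g (suc i) ≡ signedC s (suc i) ℤ.* g (suc i) ℤ.- signedC s i ℤ.* g′ i
  pascal i = begin
    signedC (suc s) (suc i) ℤ.* g (suc i)
      ≡⟨ cong (ℤ._* g (suc i)) (signedC-suc s i) ⟩
    (signedC s (suc i) ℤ.- signedC s i) ℤ.* g (suc i)
      ≡⟨ distribute (signedC s (suc i)) (signedC s i) (g (suc i)) ⟩
    signedC s (suc i) ℤ.* g (suc i) ℤ.- signedC s i ℤ.* g (suc i)
      ≡⟨ cong (λ z → signedC s (suc i) ℤ.* g (suc i) ℤ.- signedC s i ℤ.* z) (g-suc i) ⟩
    signedC s (suc i) ℤ.* g (suc i) ℤ.- signedC s i ℤ.* g′ i ∎
    where
    distribute : ∀ a b c → (a ℤ.- b) ℤ.* c ≡ a ℤ.* c ℤ.- b ℤ.* c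
    distribute = solve-∀

-- A total of at most t never meets the upper bound t on the parts, so this counts free compositions
-- of m into k + 1 parts.
boxCount-≤ : ∀ t k m → m ≤ t → boxCount t (suc k) m ≡ + ((m + k) C m)
boxCount-≤ t k m m≤t = begin
  boxCount t (suc k) m                        ≡⟨ boxCount-diff-acc t (suc k) m ⟩
  fold (fold δ acc (suc k)) (diff t) (suc k) m ≡⟨ fold-diff-≤ t (suc k) _ m m≤t ⟩
  fold δ acc (suc k) m                        ≡⟨ fold-acc-δ k m ⟩
  + ((m + k) C k)                             ≡⟨ cong +_ (nCk≡nC[n∸k] (ℕₚ.m≤n+m k m)) ⟩
  + ((m + k) C (m + k ∸ k))                   ≡⟨ cong (λ z → + ((m + k) C z)) (ℕₚ.m+n∸n≡m m k) ⟩
  + ((m + k) C m)                             ∎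

-- Writing d for s - r. The terms with i > d vanish because m < t.
boxCount-expand : ∀ t k d m → d ≤ k → m < t →
  boxCount t (suc k) (t * d + m) ≡
  ∑ (upTo (suc d)) (λ i → signedC (suc k) i ℤ.* + ((t * (d ∸ i) + m + k ∸ i) C k))
boxCount-expand t k d m d≤k m<t = begin
  boxCount t (suc k) N
    ≡⟨ boxCount-diff-acc t (suc k) N ⟩
  fold h (diff t) (suc k) N
    ≡⟨ fold-diff-expand t (suc k) 0 h N ⟨
  ∑ (upTo (suc (suc k))) term
    ≡⟨ cong (λ z → ∑ (upTo z) term) split ⟨
  ∑ (upTo ((suc k ∸ d) + suc d)) term
    ≡⟨ ∑-upTo-extend (suc d) (suc k ∸ d) term vanish ⟩
  ∑ (upTo (suc d)) term
    ≡⟨ ∑-cong-∈ (upTo (suc d)) (λ i i∈ → cong (signedC (suc k) i ℤ.*_) (value i (bound i i∈))) ⟩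
  _ ∎
  where
  N = t * d + m
  h = fold δ acc (suc k)
  term = λ i → signedC (suc k) i ℤ.* shift (i * suc t) h N
  split : (suc k ∸ d) + suc d ≡ suc (suc k)
  split = trans (ℕₚ.+-suc _ d) (cong suc (ℕₚ.m∸n+n≡m (ℕₚ.m≤n⇒m≤1+n d≤k)))
  bound : ∀ i → i ∈ₗ upTo (suc d) → i ≤ d
  bound i i∈ = ℕₚ.≤-pred (∈-upTo⁻ i∈)
  vanish : ∀ i → suc d ≤ i → term i ≡ + 0
  vanish i d<i = trans (cong (signedC (suc k) i ℤ.*_) (shift-> (i * suc t) h N N<)) (ℤₚ.*-zeroʳ (signedC (suc k) i))
    where
    N< : N < i * suc t
    N< = ℕₚ.<-≤-trans (ℕₚ.+-monoʳ-< (t * d) m<t)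
         (ℕₚ.≤-trans (ℕₚ.≤-reflexive (trans (ℕₚ.+-comm (t * d) t) (sym (ℕₚ.*-suc t d))))
         (ℕₚ.≤-trans (ℕₚ.*-monoʳ-≤ t d<i)
         (ℕₚ.≤-trans (ℕₚ.≤-reflexive (ℕₚ.*-comm t i)) (ℕₚ.*-monoʳ-≤ i (ℕₚ.n≤1+n t)))))
  rearr : ∀ j t i m → t * (j + i) + m ≡ t * j + m + i * t
  rearr = ℕ-solve
  -- The remaining exponent is t (d - i) + m - i. If it is negative the shifted coefficient is 0,
  -- and the binomial agrees because its truncated upper argument is then below k.
  value : ∀ i → i ≤ d → shift (i * suc t) h N ≡ + ((t * (d ∸ i) + m + k ∸ i) C k)
  value i i≤d with ℕₚ.≤-<-connex i (t * (d ∸ i) + m)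
  ... | inj₁ i≤ = begin
    shift (i * suc t) h N                      ≡⟨ shift-≤ (i * suc t) h N (ℕₚ.≤-trans (ℕₚ.m≤m+n (i * suc t) e) (ℕₚ.≤-reflexive (sym N≡))) ⟩
    h (N ∸ i * suc t)                          ≡⟨ cong h (trans (cong (_∸ i * suc t) N≡) (ℕₚ.m+n∸m≡n (i * suc t) e)) ⟩
    h e                                        ≡⟨ fold-acc-δ k e ⟩
    + ((e + k) C k)                            ≡⟨ cong (λ z → + (z C k)) (ℕₚ.+-∸-comm k i≤) ⟨
    + ((t * (d ∸ i) + m + k ∸ i) C k)          ∎
    where
    e = t * (d ∸ i) + m ∸ i
    arith : ∀ j e t i m → t * j + m ≡ i + e → t * (j + i) + m ≡ i * suc t + e
    arith j e t i m eq = trans (rearr j t i m) (trans (cong (_+ i * t) eq) (rearr′ e t i))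
      where
      rearr′ : ∀ e t i → i + e + i * t ≡ i * suc t + e
      rearr′ = ℕ-solve
    N≡ : N ≡ i * suc t + e
    N≡ = trans (cong (λ z → t * z + m) (sym (ℕₚ.m∸n+n≡m i≤d)))
         (arith (d ∸ i) e t i m (sym (ℕₚ.m+[n∸m]≡n i≤)))
  ... | inj₂ <i = begin
    shift (i * suc t) h N                      ≡⟨ shift-> (i * suc t) h N N< ⟩
    + 0                                        ≡⟨ cong +_ (k>n⇒nCk≡0 small) ⟨
    + ((t * (d ∸ i) + m + k ∸ i) C k)          ∎
    where
    N< : N < i * suc t
    N< = ℕₚ.≤-trans (ℕₚ.≤-reflexive (cong suc (trans (cong (λ z → t * z + m) (sym (ℕₚ.m∸n+n≡m i≤d))) (rearr (d ∸ i) t i m))))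
         (ℕₚ.≤-trans (ℕₚ.+-monoˡ-≤ (i * t) <i) (ℕₚ.≤-reflexive (sym (ℕₚ.*-suc i t))))
    small : t * (d ∸ i) + m + k ∸ i < k
    small = ℕₚ.m<n+o⇒m∸n<o (t * (d ∸ i) + m + k) i {k} {{>-nonZero (ℕₚ.<-≤-trans (ℕₚ.≤-<-trans z≤n <i) (ℕₚ.≤-trans i≤d d≤k))}} (ℕₚ.+-monoˡ-< k <i)

-- Counting the points that violate a hyperplane inequality

χ : Bool → ℤ
χ b = if b then + 1 else + 0

χ-T : ∀ {b} → T b → χ b ≡ + 1
χ-T {true} _ = refl

χ-¬T : ∀ {b} → ¬ T b → χ b ≡ + 0
χ-¬T {true}  ¬t = contradiction _ ¬t
χ-¬T {false} _  = refl

χ-∧ : ∀ a b → χ (a ∧ b) ≡ χ a ℤ.* χ b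
χ-∧ true  b = sym (ℤₚ.*-identityˡ (χ b))
χ-∧ false b = refl

χ-not : ∀ b → χ (not b) ≡ + 1 ℤ.- χ b
χ-not true  = refl
χ-not false = refl

T-extensional : ∀ {a b} → (T a → T b) → (T b → T a) → a ≡ b
T-extensional to from = ⇔→≡ {z = true} (mk⇔
  (Equivalence.to T-≡ ∘ to ∘ Equivalence.from T-≡) (Equivalence.to T-≡ ∘ from ∘ Equivalence.from T-≡))

length-filter : {A : Set} (p : A → Bool) (xs : List A) → + length (filter (T? ∘ p) xs) ≡ ∑ xs (χ ∘ p)
length-filter p []       = refl
length-filter p (x ∷ xs) with p x
... | true  = cong (ℤ._+_ (+ 1)) (length-filter p xs)
... | false = trans (length-filter p xs) (sym (ℤₚ.+-identityˡ _))

-- With at most one witness a union is counted by a plain sum, so no inclusion-exclusion over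
-- several hyperplanes arises.
∑χ-any : {A : Set} (p : A → Bool) {xs : List A} → Unique xs → (∀ x y → T (p x) → T (p y) → x ≡ y) → ∑ xs (χ ∘ p) ≡ χ (any p xs)
∑χ-any p []                  unique = refl
∑χ-any p {x ∷ xs} (x∉ ∷ uniq) unique with p x in eq
... | false = trans (ℤₚ.+-identityˡ _) (∑χ-any p uniq unique)
... | true  = cong (ℤ._+_ (+ 1)) (trans (∑-cong-∈ xs (λ y y∈ → χ-¬T (λ py →
  All.lookup x∉ y∈ (unique x y (Equivalence.from T-≡ eq) py)))) (∑-zero xs))

∑χ-select : ∀ t w (f : ℕ → ℤ) → ∑ (upTo t) (λ m → χ (w ≡ᵇ m) ℤ.* f m) ≡ χ (w <ᵇ t) ℤ.* f w
∑χ-select zero    w       f = refl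
∑χ-select (suc t) zero    f = begin
  ∑ (upTo (suc t)) (λ m → χ (0 ≡ᵇ m) ℤ.* f m)                ≡⟨ ∑-upTo-head t (λ m → χ (0 ≡ᵇ m) ℤ.* f m) ⟩
  + 1 ℤ.* f 0 ℤ.+ ∑ (upTo t) (λ m → + 0 ℤ.* f (suc m))       ≡⟨ cong (ℤ._+_ (+ 1 ℤ.* f 0)) (∑-zero (upTo t)) ⟩
  + 1 ℤ.* f 0 ℤ.+ + 0                                        ≡⟨ ℤₚ.+-identityʳ _ ⟩
  + 1 ℤ.* f 0                                                ∎
∑χ-select (suc t) (suc w) f = begin
  ∑ (upTo (suc t)) (λ m → χ (suc w ≡ᵇ m) ℤ.* f m)            ≡⟨ ∑-upTo-head t (λ m → χ (suc w ≡ᵇ m) ℤ.* f m) ⟩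
  + 0 ℤ.+ ∑ (upTo t) (λ m → χ (w ≡ᵇ m) ℤ.* f (suc m))        ≡⟨ ℤₚ.+-identityˡ _ ⟩
  ∑ (upTo t) (λ m → χ (w ≡ᵇ m) ℤ.* f (suc m))                ≡⟨ ∑χ-select t w (f ∘ suc) ⟩
  χ (w <ᵇ t) ℤ.* f (suc w)                                   ∎

∑-cartesianProductWith : {A B C : Set} (g : A → B → C) (xs : List A) (ys : List B) (f : C → ℤ) →
  ∑ (cartesianProductWith g xs ys) f ≡ ∑ xs (λ x → ∑ ys (λ y → f (g x y)))
∑-cartesianProductWith g []       ys f = refl
∑-cartesianProductWith g (x ∷ xs) ys f = trans (∑-++ (map (g x) ys) _ f)
  (cong₂ ℤ._+_ (∑-map (g x) ys f) (∑-cartesianProductWith g xs ys f))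

boxVectors : ℕ → (n : ℕ) → List (Vec ℕ n)
boxVectors t zero    = [] ∷ []
boxVectors t (suc n) = cartesianProductWith _∷_ (upTo (suc t)) (boxVectors t n)

∈-boxVectors⁺ : ∀ {t} {x : Vec ℕ n} → Bounded t x → x ∈ₗ boxVectors t n
∈-boxVectors⁺ []         = here refl
∈-boxVectors⁺ (v≤ ∷ x≤)  = ∈-cartesianProductWith⁺ _∷_ (∈-upTo⁺ (s≤s v≤)) (∈-boxVectors⁺ x≤)

∈-boxVectors⁻ : ∀ {t} {x : Vec ℕ n} → x ∈ₗ boxVectors t n → Bounded t x
∈-boxVectors⁻ {x = []} _ = []
∈-boxVectors⁻ {suc n} {t} {x = v ∷ x} x∈ with ∈-cartesianProductWith⁻ _∷_ (upTo (suc t)) (boxVectors t n) x∈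
... | _ , _ , v∈ , y∈ , refl = ℕₚ.≤-pred (∈-upTo⁻ v∈) ∷ ∈-boxVectors⁻ y∈

boxVectors-unique : ∀ t n → Unique (boxVectors t n)
boxVectors-unique t zero    = [] ∷ []
boxVectors-unique t (suc n) = Uniqueₚ.cartesianProductWith⁺ _∷_ ∷-injective (Uniqueₚ.upTo⁺ (suc t)) (boxVectors-unique t n)

subsets-unique : ∀ n → Unique (subsets n)
subsets-unique zero    = [] ∷ []
subsets-unique (suc n) = Uniqueₚ.++⁺ (Uniqueₚ.map⁺ ∷-injectiveʳ (subsets-unique n)) (Uniqueₚ.map⁺ ∷-injectiveʳ (subsets-unique n))
  disjoint
  where
  disjoint : ∀ {A} → ¬ (A ∈ₗ map (outside ∷_) (subsets n) × A ∈ₗ map (inside ∷_) (subsets n))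
  disjoint (A∈out , A∈in) with ∈-map⁻ (outside ∷_) A∈out | ∈-map⁻ (inside ∷_) A∈in
  ... | _ , _ , refl | _ , _ , ()

∑χ-shift : {A : Set} (xs : List A) (d : A → ℕ) (c : A → ℤ) (v a : ℕ) →
  ∑ xs (λ x → χ (v + d x ≡ᵇ a) ℤ.* c x) ≡ shift v (λ b → ∑ xs (λ x → χ (d x ≡ᵇ b) ℤ.* c x)) a
∑χ-shift xs d c zero    a       = refl
∑χ-shift xs d c (suc v) zero    = ∑-zero xs
∑χ-shift xs d c (suc v) (suc a) = ∑χ-shift xs d c v a

shift-*ʳ : ∀ v (f : Seq) c a → shift v (λ b → f b ℤ.* c) a ≡ shift v f a ℤ.* c
shift-*ʳ zero    f c a       = refl
shift-*ʳ (suc v) f c zero    = refl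
shift-*ʳ (suc v) f c (suc a) = shift-*ʳ v f c a

χ-0≡ᵇ : ∀ a → χ (0 ≡ᵇ a) ≡ δ a
χ-0≡ᵇ zero    = refl
χ-0≡ᵇ (suc a) = refl

-- A further coordinate in [0,t] multiplies the generating function of `d` by 1 + z + ... + z^t. The
-- factor `c` carries the condition on the other part of the vector, so the same step serves
-- coordinates inside and outside the subset.
∑χ-box : {A : Set} (t : ℕ) (xs : List A) (d : A → ℕ) (c : A → ℤ) (f : Seq) (k : ℤ) →
  (∀ a → ∑ xs (λ x → χ (d x ≡ᵇ a) ℤ.* c x) ≡ f a ℤ.* k) →
  ∀ a → ∑ (upTo (suc t)) (λ v → ∑ xs (λ x → χ (v + d x ≡ᵇ a) ℤ.* c x)) ≡ box t f a ℤ.* k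
∑χ-box t xs d c f k eq a = begin
  ∑ (upTo (suc t)) (λ v → ∑ xs (λ x → χ (v + d x ≡ᵇ a) ℤ.* c x))
    ≡⟨ ∑-cong (upTo (suc t)) (λ v → trans (∑χ-shift xs d c v a) (trans (shift-cong v eq a) (shift-*ʳ v f k a))) ⟩
  ∑ (upTo (suc t)) (λ v → shift v f a ℤ.* k)
    ≡⟨ ∑-*ʳ (upTo (suc t)) k (λ v → shift v f a) ⟩
  box t f a ℤ.* k ∎

-- Recording A by its deficit rather than its weight absorbs the symmetry v ↦ t - v of the box.
count-split : ∀ t (A : Subset n) a b →
  ∑ (boxVectors t n) (λ x → χ (deficit t A x ≡ᵇ a) ℤ.* χ (weight (∁ A) x ≡ᵇ b))
    ≡ (boxCount t ∣ A ∣ a) ℤ.* (boxCount t ∣ ∁ A ∣ b)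
count-split t []            a b = trans (ℤₚ.+-identityʳ _) (cong₂ ℤ._*_ (χ-0≡ᵇ a) (χ-0≡ᵇ b))
count-split {suc n} t (inside ∷ A) a b = begin
  ∑ (boxVectors t (suc n)) (λ x → χ (deficit t (inside ∷ A) x ≡ᵇ a) ℤ.* χ (weight (∁ (inside ∷ A)) x ≡ᵇ b))
    ≡⟨ ∑-cartesianProductWith _∷_ (upTo (suc t)) V _ ⟩
  ∑ (upTo (suc t)) (λ v → layer (t ∸ v))
    ≡⟨ ∑-upTo-reverse t layer ⟩
  ∑ (upTo (suc t)) layer
    ≡⟨ ∑χ-box t V (deficit t A) (λ x → χ (weight (∁ A) x ≡ᵇ b)) (boxCount t ∣ A ∣) _ (λ a → count-split t A a b) a ⟩
  (boxCount t (suc ∣ A ∣) a) ℤ.* (boxCount t ∣ ∁ A ∣ b) ∎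
  where
  V = boxVectors t n
  layer = λ v → ∑ V (λ x → χ (v + deficit t A x ≡ᵇ a) ℤ.* χ (weight (∁ A) x ≡ᵇ b))
count-split {suc n} t (outside ∷ A) a b = begin
  ∑ (boxVectors t (suc n)) (λ x → χ (deficit t (outside ∷ A) x ≡ᵇ a) ℤ.* χ (weight (∁ (outside ∷ A)) x ≡ᵇ b))
    ≡⟨ ∑-cartesianProductWith _∷_ (upTo (suc t)) V _ ⟩
  ∑ (upTo (suc t)) (λ v → ∑ V (λ x → χ (deficit t A x ≡ᵇ a) ℤ.* χ (v + weight (∁ A) x ≡ᵇ b)))
    ≡⟨ ∑-cong (upTo (suc t)) (λ v → ∑-cong V (λ x → ℤₚ.*-comm (χ (deficit t A x ≡ᵇ a)) _)) ⟩
  ∑ (upTo (suc t)) (λ v → ∑ V (λ x → χ (v + weight (∁ A) x ≡ᵇ b) ℤ.* χ (deficit t A x ≡ᵇ a)))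
    ≡⟨ ∑χ-box t V (weight (∁ A)) (λ x → χ (deficit t A x ≡ᵇ a)) (boxCount t ∣ ∁ A ∣) (boxCount t ∣ A ∣ a) swapped b ⟩
  (boxCount t (suc ∣ ∁ A ∣) b) ℤ.* (boxCount t ∣ A ∣ a)
    ≡⟨ ℤₚ.*-comm (boxCount t (suc ∣ ∁ A ∣) b) _ ⟩
  (boxCount t ∣ A ∣ a) ℤ.* (boxCount t (suc ∣ ∁ A ∣) b) ∎
  where
  V = boxVectors t n
  swapped : ∀ b → ∑ V (λ x → χ (weight (∁ A) x ≡ᵇ b) ℤ.* χ (deficit t A x ≡ᵇ a)) ≡ (boxCount t ∣ ∁ A ∣ b) ℤ.* (boxCount t ∣ A ∣ a)
  swapped b = trans (∑-cong V (λ x → ℤₚ.*-comm (χ (weight (∁ A) x ≡ᵇ b)) _))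
    (trans (count-split t A a b) (ℤₚ.*-comm (boxCount t ∣ A ∣ a) _))

onSlice : ℕ → ℕ → Vec ℕ n → Bool
onSlice r t x = Vec.sum x ≡ᵇ r * t

-- The inequality x(A) ≤ (r - 1) t, with t added to both sides, fails.
violates : ℕ → ℕ → Subset n → Vec ℕ n → Bool
violates r t A x = r * t <ᵇ weight A x + t

-- On the slice x(A) = r t - x(∁ A). Hence the inequality fails exactly when x(∁ A) < t, and the
-- deficit |A| t - x(A) equals t (|A| - r) + x(∁ A).
violates-iff : ∀ {r t} (A : Subset n) {x : Vec ℕ n} → Bounded t x → r ≤ ∣ A ∣ →
  (onSlice r t x ∧ violates r t A x) ≡ ((weight (∁ A) x <ᵇ t) ∧ (deficit t A x ≡ᵇ t * (∣ A ∣ ∸ r) + weight (∁ A) x))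
violates-iff {r = r} {t} A {x} x≤ r≤ = T-extensional to from
  where
  w = weight A x
  w̄ = weight (∁ A) x
  d = deficit t A x
  K = t * (∣ A ∣ ∸ r)
  w+w̄ : w + w̄ ≡ Vec.sum x
  w+w̄ = weight+weight-∁ A x
  d+w : d + w ≡ K + r * t
  d+w = begin
    d + w                      ≡⟨ deficit+weight A x≤ ⟩
    ∣ A ∣ * t                  ≡⟨ cong (_* t) (ℕₚ.m∸n+n≡m r≤) ⟨
    (∣ A ∣ ∸ r + r) * t        ≡⟨ ℕₚ.*-distribʳ-+ t (∣ A ∣ ∸ r) r ⟩
    (∣ A ∣ ∸ r) * t + r * t    ≡⟨ cong (_+ r * t) (ℕₚ.*-comm (∣ A ∣ ∸ r) t) ⟩
    K + r * t                  ∎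
  swap-right : ∀ k a b → k + (a + b) ≡ k + b + a
  swap-right = ℕ-solve
  to : T (onSlice r t x ∧ violates r t A x) → T ((w̄ <ᵇ t) ∧ (d ≡ᵇ K + w̄))
  to h with Equivalence.to (T-∧ {onSlice r t x}) h
  ... | slice , viol = Equivalence.from T-∧
    ( ℕₚ.<⇒<ᵇ (ℕₚ.+-cancelˡ-< w w̄ t (subst (_< w + t) (sym w+w̄≡) (ℕₚ.<ᵇ⇒< _ _ viol)))
    , ℕₚ.≡⇒≡ᵇ _ _ (ℕₚ.+-cancelʳ-≡ w d (K + w̄) (trans d+w (trans (cong₂ _+_ refl (sym w+w̄≡)) (swap-right K w w̄)))) )
    where
    w+w̄≡ : w + w̄ ≡ r * t
    w+w̄≡ = trans w+w̄ (ℕₚ.≡ᵇ⇒≡ (Vec.sum x) (r * t) slice)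
  from : T ((w̄ <ᵇ t) ∧ (d ≡ᵇ K + w̄)) → T (onSlice r t x ∧ violates r t A x)
  from h with Equivalence.to (T-∧ {w̄ <ᵇ t}) h
  ... | w̄<t , d≡ = Equivalence.from T-∧
    ( ℕₚ.≡⇒≡ᵇ _ _ (trans (sym w+w̄) w+w̄≡)
    , ℕₚ.<⇒<ᵇ (subst (_< w + t) w+w̄≡ (ℕₚ.+-monoʳ-< w (ℕₚ.<ᵇ⇒< _ _ w̄<t))) )
    where
    w+w̄≡ : w + w̄ ≡ r * t
    w+w̄≡ = ℕₚ.+-cancelˡ-≡ K (w + w̄) (r * t) (trans (swap-right K w w̄) (trans (cong (_+ w) (sym (ℕₚ.≡ᵇ⇒≡ d _ d≡))) d+w))

violators : ℕ → ℕ → Subset n → ℤ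
violators {n} r t A = ∑ (boxVectors t n) (λ x → χ (onSlice r t x ∧ violates r t A x))

-- A verbatim copy of the factor of `numHyperplanes` in `correction`, so that the two agree by
-- definition.
correctionTerm : ℕ → ℕ → ℕ → ℕ → ℤ
correctionTerm n r t s =
  ∑ (upTo t) (λ m →
    ∑ (upTo (suc (s ∸ r))) (λ i →
      (-[1+ 0 ] ℤ.^ i) ℤ.*
      + ((s C i) * ((t * (s ∸ r ∸ i) + m + s ∸ 1 ∸ i) C (s ∸ 1)) * ((m + n ∸ s ∸ 1) C m))))

violators-small : ∀ {r t} (A : Subset n) → ∣ A ∣ < r → violators r t A ≡ + 0
violators-small {n} {r} {t} A small = trans (∑-cong-∈ (boxVectors t n) none) (∑-zero (boxVectors t n))
  where
  none : ∀ x → x ∈ₗ boxVectors t n → χ (onSlice r t x ∧ violates r t A x) ≡ + 0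
  none x x∈ = χ-¬T λ h → ℕₚ.<⇒≱ (ℕₚ.<ᵇ⇒< (r * t) (weight A x + t) (proj₂ (Equivalence.to (T-∧ {onSlice r t x}) h)))
    (ℕₚ.≤-trans (ℕₚ.+-monoˡ-≤ t (weight-≤ A (∈-boxVectors⁻ x∈)))
    (ℕₚ.≤-trans (ℕₚ.≤-reflexive (ℕₚ.+-comm (∣ A ∣ * t) t)) (ℕₚ.*-monoˡ-≤ t small)))

violators-boxCount : ∀ {r t} (A : Subset n) → r ≤ ∣ A ∣ →
  violators r t A ≡ ∑ (upTo t) (λ m → (boxCount t ∣ A ∣ (t * (∣ A ∣ ∸ r) + m)) ℤ.* (boxCount t ∣ ∁ A ∣ m))
violators-boxCount {n} {r} {t} A r≤ = begin
  violators r t A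
    ≡⟨ ∑-cong-∈ V pointwise ⟩
  ∑ V (λ x → ∑ (upTo t) (λ m → χ (deficit t A x ≡ᵇ K + m) ℤ.* χ (weight (∁ A) x ≡ᵇ m)))
    ≡⟨ ∑-swap V (upTo t) _ ⟩
  ∑ (upTo t) (λ m → ∑ V (λ x → χ (deficit t A x ≡ᵇ K + m) ℤ.* χ (weight (∁ A) x ≡ᵇ m)))
    ≡⟨ ∑-cong (upTo t) (λ m → count-split t A (K + m) m) ⟩
  _ ∎
  where
  V = boxVectors t n
  K = t * (∣ A ∣ ∸ r)
  pointwise : ∀ x → x ∈ₗ V → χ (onSlice r t x ∧ violates r t A x)
    ≡ ∑ (upTo t) (λ m → χ (deficit t A x ≡ᵇ K + m) ℤ.* χ (weight (∁ A) x ≡ᵇ m))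
  pointwise x x∈ = begin
    χ (onSlice r t x ∧ violates r t A x)
      ≡⟨ cong χ (violates-iff {r = r} A (∈-boxVectors⁻ x∈) r≤) ⟩
    χ ((w̄ <ᵇ t) ∧ (d ≡ᵇ K + w̄))
      ≡⟨ χ-∧ (w̄ <ᵇ t) _ ⟩
    χ (w̄ <ᵇ t) ℤ.* χ (d ≡ᵇ K + w̄)
      ≡⟨ ∑χ-select t w̄ (λ m → χ (d ≡ᵇ K + m)) ⟨
    ∑ (upTo t) (λ m → χ (w̄ ≡ᵇ m) ℤ.* χ (d ≡ᵇ K + m))
      ≡⟨ ∑-cong (upTo t) (λ m → ℤₚ.*-comm (χ (w̄ ≡ᵇ m)) _) ⟩
    ∑ (upTo t) (λ m → χ (d ≡ᵇ K + m) ℤ.* χ (w̄ ≡ᵇ m)) ∎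
    where
    w̄ = weight (∁ A) x
    d = deficit t A x

-- From 1 ≤ r ≤ |A| < n both `A` and its complement are nonempty. So s - 1 and n - s - 1 are not
-- truncated: they are the `k` and `j` for which the two parts have k + 1 and j + 1 coordinates.
violators-formula : ∀ {r t} (A : Subset n) → 1 ≤ r → r ≤ ∣ A ∣ → ∣ A ∣ < n → violators r t A ≡ correctionTerm n r t ∣ A ∣
violators-formula {n} {suc r} {t} A _ r≤ <n with ∣ A ∣ in ∣A∣≡ | r≤
... | suc k | s≤s r≤k = begin
  violators (suc r) t A
    ≡⟨ violators-boxCount A (ℕₚ.≤-trans (s≤s r≤k) (ℕₚ.≤-reflexive (sym ∣A∣≡))) ⟩
  ∑ (upTo t) (λ m → (boxCount t ∣ A ∣ (t * (∣ A ∣ ∸ suc r) + m)) ℤ.* (boxCount t ∣ ∁ A ∣ m))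
    ≡⟨ cong₂ (λ s s′ → ∑ (upTo t) (λ m → boxCount t s (t * (s ∸ suc r) + m) ℤ.* boxCount t s′ m)) ∣A∣≡ ∣∁A∣≡ ⟩
  ∑ (upTo t) (λ m → boxCount t (suc k) (t * (k ∸ r) + m) ℤ.* boxCount t (suc j) m)
    ≡⟨ ∑-cong-∈ (upTo t) (λ m m∈ → trans (cong₂ ℤ._*_
         (boxCount-expand t k (k ∸ r) m (ℕₚ.m∸n≤m k r) (∈-upTo⁻ m∈)) (boxCount-≤ t j m (ℕₚ.<⇒≤ (∈-upTo⁻ m∈))))
         (sym (∑-*ʳ (upTo (suc (k ∸ r))) (+ ((m + j) C m)) (λ i → signedC (suc k) i ℤ.* + ((t * (k ∸ r ∸ i) + m + k ∸ i) C k))))) ⟩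
  ∑ (upTo t) (λ m → ∑ (upTo (suc (k ∸ r))) (λ i → signedC (suc k) i ℤ.* + ((t * (k ∸ r ∸ i) + m + k ∸ i) C k) ℤ.* + ((m + j) C m)))
    ≡⟨ ∑-cong (upTo t) (λ m → ∑-cong (upTo (suc (k ∸ r))) (λ i → reshape m i)) ⟩
  correctionTerm n (suc r) t (suc k) ∎
  where
  j = n ∸ suc (suc k)
  n∸ : n ∸ suc k ≡ suc j
  n∸ = ℕₚ.+-∸-assoc 1 <n
  ∣∁A∣≡ : ∣ ∁ A ∣ ≡ suc j
  ∣∁A∣≡ = trans (∣∁p∣≡n∸∣p∣ A) (trans (cong (n ∸_) ∣A∣≡) n∸)
  top₁ : ∀ m i → t * (k ∸ r ∸ i) + m + suc k ∸ 1 ∸ i ≡ t * (k ∸ r ∸ i) + m + k ∸ i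
  top₁ m i = cong (λ z → z ∸ 1 ∸ i) (ℕₚ.+-suc (t * (k ∸ r ∸ i) + m) k)
  top₂ : ∀ m → m + n ∸ suc k ∸ 1 ≡ m + j
  top₂ m = trans (cong (_∸ 1) (trans (ℕₚ.+-∸-assoc m (ℕₚ.<⇒≤ <n)) (cong₂ _+_ refl n∸))) (cong (_∸ 1) (ℕₚ.+-suc m j))
  reshape : ∀ m i → signedC (suc k) i ℤ.* + ((t * (k ∸ r ∸ i) + m + k ∸ i) C k) ℤ.* + ((m + j) C m)
    ≡ (-[1+ 0 ] ℤ.^ i) ℤ.* + ((suc k C i) * ((t * (k ∸ r ∸ i) + m + suc k ∸ 1 ∸ i) C k) * ((m + n ∸ suc k ∸ 1) C m))
  reshape m i = trans (regroup (-[1+ 0 ] ℤ.^ i) (suc k C i) _ _)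
    (cong₂ (λ u v → (-[1+ 0 ] ℤ.^ i) ℤ.* + ((suc k C i) * (u C k) * (v C m))) (sym (top₁ m i)) (sym (top₂ m)))
    where
    regroup : ∀ p a b c → p ℤ.* + a ℤ.* + b ℤ.* + c ≡ p ℤ.* + (a * b * c)
    regroup p a b c = begin
      p ℤ.* + a ℤ.* + b ℤ.* + c        ≡⟨ assoc p (+ a) (+ b) (+ c) ⟩
      p ℤ.* (+ a ℤ.* + b ℤ.* + c)      ≡⟨ cong (λ z → p ℤ.* (z ℤ.* + c)) (ℤₚ.pos-* a b) ⟨
      p ℤ.* (+ (a * b) ℤ.* + c)        ≡⟨ cong (p ℤ.*_) (ℤₚ.pos-* (a * b) c) ⟨
      p ℤ.* + (a * b * c)              ∎
      where
      assoc : ∀ p a b c → p ℤ.* a ℤ.* b ℤ.* c ≡ p ℤ.* (a ℤ.* b ℤ.* c)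
      assoc = solve-∀

-- Ehrhart counts

toℤ-injective : {x y : Vec ℕ n} → toℤ x ≡ toℤ y → x ≡ y
toℤ-injective {x = []}    {[]}    _  = refl
toℤ-injective {x = v ∷ x} {w ∷ y} eq =
  cong₂ _∷_ (ℤₚ.+-injective (proj₁ (∷-injective eq))) (toℤ-injective (proj₂ (∷-injective eq)))

-- All integer points of the dilate lie in [0,t]^n, so filtering this box lists them. Using one box
-- for both matroids makes the difference of the counts a sum over it.
ehrIs-filter : (isB : Subset n → Bool) (t : ℕ) (p : Vec ℕ n → Bool) →
  (∀ y → Bounded t y → T (p y) → InDilatedBasePolytope isB t (toℤ y)) →
  (∀ y → InDilatedBasePolytope isB t (toℤ y) → T (p y)) →
  EhrIs isB t (length (filter (T? ∘ p) (boxVectors t n)))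
ehrIs-filter {n} isB t p sound complete =
  map toℤ L
  , Uniqueₚ.map⁺ toℤ-injective (Uniqueₚ.filter⁺ (T? ∘ p) (boxVectors-unique t n))
  , Listₚ.length-map toℤ L
  , Allₚ.map⁺ (All.tabulate inside-polytope)
  , listed
  where
  L = filter (T? ∘ p) (boxVectors t n)
  inside-polytope : ∀ {y} → y ∈ₗ L → InDilatedBasePolytope isB t (toℤ y)
  inside-polytope y∈ with ∈-filter⁻ (T? ∘ p) {xs = boxVectors t n} y∈
  ... | y∈box , py = sound _ (∈-boxVectors⁻ y∈box) py
  listed : ∀ x → InDilatedBasePolytope isB t x → x ∈ₗ map toℤ L
  listed x x∈P with polytope-nonNegative isB t x x∈P
  ... | y , refl = ∈-map⁺ toℤ
    (∈-filter⁺ (T? ∘ p) (∈-boxVectors⁺ (polytope-bounded isB t y x∈P)) (complete y x∈P))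

uniform-ehrIs : ∀ n r t → EhrIs (uniformBasis {n} r) t (length (filter (T? ∘ onSlice r t) (boxVectors t n)))
uniform-ehrIs n r t = ehrIs-filter (uniformBasis r) t (onSlice r t) sound
  (λ y y∈P → ℕₚ.≡⇒≡ᵇ _ _ (polytope-sum (uniformBasis r) t y (λ B → ℕₚ.≡ᵇ⇒≡ ∣ B ∣ r) y∈P))
  where
  sound : ∀ y → Bounded t y → T (onSlice r t y) → InDilatedBasePolytope (uniformBasis r) t (toℤ y)
  sound y y≤ slice with uniform-decomposition t r y y≤ (ℕₚ.≡ᵇ⇒≡ _ _ slice)
  ... | Bs , len , sizes , mult = decomposition⇒polytope Bs y len (All.map (λ {B} → ℕₚ.≡⇒≡ᵇ ∣ B ∣ r) sizes) mult

module _ (M : Matroid n) {r : ℕ} (rank : HasRank M r) (paving : Paving M r) (t : ℕ) where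

  private
    H? = isHyperplane M r

  violatesHyperplane : Vec ℕ n → Bool
  violatesHyperplane x = any (λ H → H? H ∧ violates r t H x) (subsets n)

  inPolytope : Vec ℕ n → Bool
  inPolytope x = onSlice r t x ∧ not (violatesHyperplane x)

  hyperplane-size : ∀ H → Hyperplane M rank H → ∣ H ∣ < n
  hyperplane-size H h = ℕₚ.≤∧≢⇒< (∣p∣≤n H) λ eq →
    hyperplane⇒basis⊈ M rank H h (proj₂ (nonempty M)) (λ {x} _ → subst (x ∈_) (sym (∣p∣≡n⇒p≡⊤ eq)) ∈⊤)

  hyperplane⇒1≤r : ∀ H → Hyperplane M rank H → 1 ≤ r
  hyperplane⇒1≤r H h = subst (1 ≤_) (hyperplane⇒rk M rank H h) (s≤s z≤n)

  paving-ehrIs : EhrIs (isBasis M) t (length (filter (T? ∘ inPolytope) (boxVectors t n)))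
  paving-ehrIs = ehrIs-filter (isBasis M) t inPolytope sound complete
    where
    sound : ∀ y → Bounded t y → T (inPolytope y) → InDilatedBasePolytope (isBasis M) t (toℤ y)
    sound y y≤ ok with Equivalence.to (T-∧ {onSlice r t y}) ok
    ... | slice , ¬viol with paving-decomposition M rank paving t y y≤ (ℕₚ.≡ᵇ⇒≡ _ _ slice) satisfied
      where
      satisfied : ∀ H → Hyperplane M rank H → weight H y + t ≤ r * t
      satisfied H h = ℕₚ.≮⇒≥ λ lt → subst T (Equivalence.to T-not-≡ ¬viol)
        (any⁺ _ (lose (∈-subsets H) (Equivalence.from T-∧ (h , ℕₚ.<⇒<ᵇ lt))))
    ...   | Bs , len , bs , mult = decomposition⇒polytope Bs y len bs mult
    complete : ∀ y → InDilatedBasePolytope (isBasis M) t (toℤ y) → T (inPolytope y)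
    complete y y∈P = Equivalence.from T-∧
      ( ℕₚ.≡⇒≡ᵇ _ _ (polytope-sum (isBasis M) t y rank y∈P)
      , not-T none )
      where
      not-T : ∀ {b} → ¬ T b → T (not b)
      not-T {true}  ¬t = ¬t _
      not-T {false} _  = _
      none : ¬ T (violatesHyperplane y)
      none v with find (any⁻ (λ H → H? H ∧ violates r t H y) (subsets n) v)
      ... | H , _ , hv with Equivalence.to (T-∧ {H? H}) hv
      ...   | h , viol = ℕₚ.<⇒≱ (ℕₚ.<ᵇ⇒< (r * t) _ viol) (polytope-hyperplane M rank t y∈P H h)

  -- Sharing r - 1 elements forces equality; otherwise adding the two strict inequalities
  -- contradicts `overlap-bound`.
  violated-hyperplane-unique : ∀ {x} → Bounded t x → T (onSlice r t x) → ∀ H H′ →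
    T (H? H ∧ violates r t H x) → T (H? H′ ∧ violates r t H′ x) → H ≡ H′
  violated-hyperplane-unique {x} x≤ slice H H′ hv hv′
    with Equivalence.to (T-∧ {H? H}) hv | Equivalence.to (T-∧ {H? H′}) hv′
  ... | h , viol | h′ , viol′ with r ℕₚ.≤? suc ∣ H ∩ H′ ∣
  ...   | yes r≤ = hyperplane-unique M rank paving H H′ h h′ r≤
  ...   | no r≰  = contradiction
    (ℕₚ.+-mono-< (ℕₚ.<ᵇ⇒< (r * t) (weight H x + t) viol) (ℕₚ.<ᵇ⇒< (r * t) (weight H′ x + t) viol′))
    (ℕₚ.≤⇒≯ (overlap-bound H H′ x≤ (ℕₚ.≡ᵇ⇒≡ _ _ slice) (ℕₚ.≰⇒> r≰)))

  hyperplane-violators : ∀ H → ∑ (boxVectors t n) (λ x → χ (onSlice r t x) ℤ.* χ (H? H ∧ violates r t H x)) ≡ χ (H? H) ℤ.* violators r t H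
  hyperplane-violators H = trans (∑-cong (boxVectors t n) pointwise) (∑-*ˡ (boxVectors t n) (χ (H? H)) (λ x → χ (onSlice r t x ∧ violates r t H x)))
    where
    pointwise : ∀ x → χ (onSlice r t x) ℤ.* χ (H? H ∧ violates r t H x) ≡ χ (H? H) ℤ.* χ (onSlice r t x ∧ violates r t H x)
    pointwise x with H? H | onSlice r t x
    ... | true  | true  = refl
    ... | true  | false = refl
    ... | false | true  = refl
    ... | false | false = refl

  -- Hyperplanes with fewer than r elements are absent from the formula and have no violators. For
  -- the others the only surviving index is |H| - r, which is in range because |H| < n.
  ∑-correctionTerm : ∀ H → χ (H? H) ℤ.* violators r t H
    ≡ ∑ (upTo (n ∸ r)) (λ k → χ (H? H ∧ (∣ H ∣ ≡ᵇ r + k)) ℤ.* correctionTerm n r t (r + k))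
  ∑-correctionTerm H with H? H in isH
  ... | false = sym (∑-zero (upTo (n ∸ r)))
  ... | true  = trans (ℤₚ.*-identityˡ (violators r t H)) (by-size (ℕₚ.≤-<-connex r ∣ H ∣))
    where
    h : Hyperplane M rank H
    h = Equivalence.from T-≡ isH
    by-size : _ → violators r t H ≡ ∑ (upTo (n ∸ r)) (λ k → χ (∣ H ∣ ≡ᵇ r + k) ℤ.* correctionTerm n r t (r + k))
    by-size (inj₂ small) = trans (violators-small H small) (sym (trans
      (∑-cong (upTo (n ∸ r)) (λ k → cong (ℤ._* correctionTerm n r t (r + k))
        (χ-¬T (λ eq → ℕₚ.<⇒≱ small (ℕₚ.≤-trans (ℕₚ.m≤m+n r k) (ℕₚ.≤-reflexive (sym (ℕₚ.≡ᵇ⇒≡ _ _ eq))))))))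
      (∑-zero (upTo (n ∸ r)))))
    by-size (inj₁ r≤) = begin
      violators r t H
        ≡⟨ violators-formula H (hyperplane⇒1≤r H h) r≤ (hyperplane-size H h) ⟩
      correctionTerm n r t ∣ H ∣
        ≡⟨ cong (correctionTerm n r t) r+e≡ ⟨
      correctionTerm n r t (r + e)
        ≡⟨ ℤₚ.*-identityˡ _ ⟨
      + 1 ℤ.* correctionTerm n r t (r + e)
        ≡⟨ cong (ℤ._* correctionTerm n r t (r + e)) (χ-T (ℕₚ.<⇒<ᵇ (ℕₚ.∸-monoˡ-< (hyperplane-size H h) r≤))) ⟨
      χ (e <ᵇ n ∸ r) ℤ.* correctionTerm n r t (r + e)
        ≡⟨ ∑χ-select (n ∸ r) e (λ k → correctionTerm n r t (r + k)) ⟨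
      ∑ (upTo (n ∸ r)) (λ k → χ (e ≡ᵇ k) ℤ.* correctionTerm n r t (r + k))
        ≡⟨ ∑-cong (upTo (n ∸ r)) (λ k → cong (λ b → χ b ℤ.* correctionTerm n r t (r + k)) (trans (sym (cancel r e k)) (cong (_≡ᵇ r + k) r+e≡))) ⟩
      ∑ (upTo (n ∸ r)) (λ k → χ (∣ H ∣ ≡ᵇ r + k) ℤ.* correctionTerm n r t (r + k)) ∎
      where
      e = ∣ H ∣ ∸ r
      r+e≡ : r + e ≡ ∣ H ∣
      r+e≡ = ℕₚ.m+[n∸m]≡n r≤
      cancel : ∀ r e k → (r + e ≡ᵇ r + k) ≡ (e ≡ᵇ k)
      cancel zero    e k = refl
      cancel (suc r) e k = cancel r e k

  correction-violators : correction M r t ≡ ∑ (subsets n) (λ H → χ (H? H) ℤ.* violators r t H)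
  correction-violators = begin
    correction M r t
      ≡⟨ ∑-map (λ k → r + k) (upTo (n ∸ r)) (λ s → + numHyperplanes M r s ℤ.* correctionTerm n r t s) ⟩
    ∑ K (λ k → + numHyperplanes M r (r + k) ℤ.* correctionTerm n r t (r + k))
      ≡⟨ ∑-cong K (λ k → cong (ℤ._* correctionTerm n r t (r + k)) (length-filter (λ H → H? H ∧ (∣ H ∣ ≡ᵇ r + k)) (subsets n))) ⟩
    ∑ K (λ k → ∑ (subsets n) (λ H → χ (H? H ∧ (∣ H ∣ ≡ᵇ r + k))) ℤ.* correctionTerm n r t (r + k))
      ≡⟨ ∑-cong K (λ k → ∑-*ʳ (subsets n) (correctionTerm n r t (r + k)) (λ H → χ (H? H ∧ (∣ H ∣ ≡ᵇ r + k)))) ⟨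
    ∑ K (λ k → ∑ (subsets n) (λ H → χ (H? H ∧ (∣ H ∣ ≡ᵇ r + k)) ℤ.* correctionTerm n r t (r + k)))
      ≡⟨ ∑-swap K (subsets n) _ ⟩
    ∑ (subsets n) (λ H → ∑ K (λ k → χ (H? H ∧ (∣ H ∣ ≡ᵇ r + k)) ℤ.* correctionTerm n r t (r + k)))
      ≡⟨ ∑-cong (subsets n) ∑-correctionTerm ⟨
    ∑ (subsets n) (λ H → χ (H? H) ℤ.* violators r t H) ∎
    where
    K = upTo (n ∸ r)

  -- Keeping the slice indicator inside the sum makes every term vanish off the slice, where several
  -- hyperplane inequalities might fail at once.
  χ-inPolytope : ∀ x → x ∈ₗ boxVectors t n → χ (inPolytope x)
    ≡ χ (onSlice r t x) ℤ.- ∑ (subsets n) (λ H → χ (onSlice r t x) ℤ.* χ (H? H ∧ violates r t H x))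
  χ-inPolytope x x∈ with onSlice r t x in slice
  ... | false = cong (ℤ._-_ (+ 0)) (sym (∑-zero (subsets n)))
  ... | true  = begin
    χ (not (violatesHyperplane x))
      ≡⟨ χ-not (violatesHyperplane x) ⟩
    + 1 ℤ.- χ (violatesHyperplane x)
      ≡⟨ cong (ℤ._-_ (+ 1)) (∑χ-any _ (subsets-unique n)
           (violated-hyperplane-unique (∈-boxVectors⁻ x∈) (Equivalence.from T-≡ slice))) ⟨
    + 1 ℤ.- ∑ (subsets n) (λ H → χ (H? H ∧ violates r t H x))
      ≡⟨ cong (ℤ._-_ (+ 1)) (∑-cong (subsets n) (λ H → ℤₚ.*-identityˡ _)) ⟨
    + 1 ℤ.- ∑ (subsets n) (λ H → + 1 ℤ.* χ (H? H ∧ violates r t H x)) ∎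

  paving-count : + length (filter (T? ∘ inPolytope) (boxVectors t n))
    ≡ + length (filter (T? ∘ onSlice r t) (boxVectors t n)) ℤ.- correction M r t
  paving-count = begin
    + length (filter (T? ∘ inPolytope) V)
      ≡⟨ length-filter inPolytope V ⟩
    ∑ V (χ ∘ inPolytope)
      ≡⟨ ∑-cong-∈ V χ-inPolytope ⟩
    ∑ V (λ x → χ (onSlice r t x) ℤ.- ∑ (subsets n) (λ H → χ (onSlice r t x) ℤ.* χ (H? H ∧ violates r t H x)))
      ≡⟨ ∑-sub V (χ ∘ onSlice r t) _ ⟩
    ∑ V (χ ∘ onSlice r t) ℤ.- ∑ V (λ x → ∑ (subsets n) (λ H → χ (onSlice r t x) ℤ.* χ (H? H ∧ violates r t H x)))
      ≡⟨ cong₂ ℤ._-_ (sym (length-filter (onSlice r t) V)) (∑-swap V (subsets n) _) ⟩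
    + length (filter (T? ∘ onSlice r t) V) ℤ.- ∑ (subsets n) (λ H → ∑ V (λ x → χ (onSlice r t x) ℤ.* χ (H? H ∧ violates r t H x)))
      ≡⟨ cong (ℤ._-_ (+ length (filter (T? ∘ onSlice r t) V))) (trans (∑-cong (subsets n) hyperplane-violators) (sym correction-violators)) ⟩
    + length (filter (T? ∘ onSlice r t) V) ℤ.- correction M r t ∎
    where V = boxVectors t n

theorem5p9 : (n r : ℕ) (M : Matroid n) → HasRank M r → Paving M r →
    (t : ℕ) →
    Σ ℕ λ eM → Σ ℕ λ eU →
    EhrIs (isBasis M) t eM × EhrIs (uniformBasis {n} r) t eU ×
    (+ eM ≡ (+ eU) - correction M r t)
theorem5p9 n r M rank paving t =
  _ , _ , paving-ehrIs M rank paving t , uniform-ehrIs n r t , paving-count M rank paving t
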